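{- Parameterized by $k+s_{\max}+o_{\max}$, \textsc{Set Cover with Capacities} is solvable in $\mathcal{O}\Big((n+m)\cdot \big(s_{\max}\cdot o_{\max}\big)^k\Big)$ time.
   Context: Write $[n]=\{1,\dots,n\}$. An instance of \textsc{Set Cover with Capacities} consists of a universe $U=[n]$, a list of capacities $c_1,\dots,c_n\in[m]$, a family of subsets $\mathcal{F}=\{F_1,\dots,F_m\}$ over $U$, and an integer $k\in\mathbb{N}$. The question is whether there exists a subset $\mathcal{S}\subseteq\mathcal{F}$ with $|\mathcal{S}|=k$ such that each element $i\in U$ is included in at most $c_i$ sets from $\mathcal{S}$. For $i\in U$ let $\mathcal{F}(i)$ denote the subfamily of sets of $\mathcal{F}$ containing $i$. Then $s_{\max}=\max_{j\in[m]}|F_j|$ is the maximum size of a set from the family and $o_{\max}=\max_{i\in[n]}|\mathcal{F}(i)|$ is the maximum number of occurrences of an element in sets from the family. -}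

module Defs where

open import Data.Bool using (if_then_else_)
open import Data.Fin using (Fin; toℕ)
open import Data.Fin.Subset using (Subset; ∣_∣; _∩_)
open import Data.Fin.Subset.Properties using (_∈?_)
open import Data.List as List using (List; []; _∷_; _++_; concatMap; filter; allFin)
open import Data.Nat using (ℕ; zero; suc; pred; _+_; _*_; _⊔_; _≤_; _<_; _≡ᵇ_; _^_)
open import Data.Product using (_×_; ∃-syntax)
open import Data.Vec using (lookup; tabulate)
open import Data.Vec.Functional using (foldr)
open import Function.Bundles using (_⇔_)
open import Relation.Binary.PropositionalEquality using (_≡_)

------------------------------------------------------------------------
-- Set Cover with Capacities

-- The universe [n] is Fin n and the family is F₁,…,Fₘ, indexed by Fin m;
-- repeated members are allowed, and subfamilies are sets of indices.
record Instance : Set where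
  field
    n m   : ℕ
    cap   : Fin n → ℕ
    1≤cap : ∀ i → 1 ≤ cap i
    cap≤m : ∀ i → cap i ≤ m
    F     : Fin m → Subset n
    k     : ℕ

  occurrences : Fin n → Subset m
  occurrences i = tabulate λ j → lookup (F j) i

  -- A maximum over an empty range is 0.
  s-max : ℕ
  s-max = foldr _⊔_ 0 λ j → ∣ F j ∣

  o-max : ℕ
  o-max = foldr _⊔_ 0 λ i → ∣ occurrences i ∣

  Solvable : Set
  Solvable = ∃[ S ] ∣ S ∣ ≡ k × (∀ i → ∣ S ∩ occurrences i ∣ ≤ cap i)

------------------------------------------------------------------------
-- Random access machine
--
-- A uniform-cost RAM with structured control flow.  Memory consists of
-- scalar variables and arrays of natural numbers; a program mentions only
-- finitely many of each by name.  Array cells are addressed by computed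
-- indices.  Arithmetic is limited to successor and predecessor, so after t
-- steps no number exceeds the largest constant or input number by more than
-- t: unit cost per operation cannot be exploited with huge numbers.  Each
-- construct takes constant time on a RAM with addition or on a word RAM.

data Expr : Set where
  lit     : ℕ → Expr
  var     : ℕ → Expr
  suc-of  : Expr → Expr
  pred-of : Expr → Expr
  _[_]    : ℕ → Expr → Expr

infix  5 _≔_ _[_]≔_
infixr 4 _⨾_

data Program : Set where
  _≔_     : ℕ → Expr → Program
  _[_]≔_  : ℕ → Expr → Expr → Program
  _⨾_     : Program → Program → Program
  if<     : Expr → Expr → Program → Program → Program
  while<  : Expr → Expr → Program → Program

record State : Set where
  constructor state
  field
    vars   : ℕ → ℕ
    arrays : ℕ → ℕ → ℕ

open State public

update : {A : Set} → (ℕ → A) → ℕ → A → ℕ → A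
update f x a y = if x ≡ᵇ y then a else f y

setVar : ℕ → ℕ → State → State
setVar x v σ = state (update (vars σ) x v) (arrays σ)

setCell : ℕ → ℕ → ℕ → State → State
setCell a i v σ =
  state (vars σ) (update (arrays σ) a (update (arrays σ a) i v))

⟦_⟧ : Expr → State → ℕ
⟦ lit c     ⟧ σ = c
⟦ var x     ⟧ σ = vars σ x
⟦ suc-of e  ⟧ σ = suc (⟦ e ⟧ σ)
⟦ pred-of e ⟧ σ = pred (⟦ e ⟧ σ)
⟦ a [ e ]   ⟧ σ = arrays σ a (⟦ e ⟧ σ)

cost : Expr → ℕ
cost (lit _)     = 1
cost (var _)     = 1
cost (suc-of e)  = suc (cost e)
cost (pred-of e) = suc (cost e)
cost (_ [ e ])   = suc (cost e)

infix 3 _,_⇓_in-time_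

-- P , σ ⇓ τ in-time t: started in σ, P halts in τ after exactly t steps.
data _,_⇓_in-time_ : Program → State → State → ℕ → Set where

  assign : ∀ {x e σ} →
    x ≔ e , σ ⇓ setVar x (⟦ e ⟧ σ) σ in-time suc (cost e)

  store : ∀ {a d e σ} →
    a [ d ]≔ e , σ ⇓ setCell a (⟦ d ⟧ σ) (⟦ e ⟧ σ) σ
      in-time suc (cost d + cost e)

  seq : ∀ {P Q σ τ υ s t} →
    P , σ ⇓ τ in-time s →
    Q , τ ⇓ υ in-time t →
    P ⨾ Q , σ ⇓ υ in-time s + t

  if-true : ∀ {d e P Q σ τ t} →
    ⟦ d ⟧ σ < ⟦ e ⟧ σ →
    P , σ ⇓ τ in-time t →
    if< d e P Q , σ ⇓ τ in-time suc (cost d + cost e) + t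

  if-false : ∀ {d e P Q σ τ t} →
    ⟦ e ⟧ σ ≤ ⟦ d ⟧ σ →
    Q , σ ⇓ τ in-time t →
    if< d e P Q , σ ⇓ τ in-time suc (cost d + cost e) + t

  while-true : ∀ {d e P σ τ υ s t} →
    ⟦ d ⟧ σ < ⟦ e ⟧ σ →
    P , σ ⇓ τ in-time s →
    while< d e P , τ ⇓ υ in-time t →
    while< d e P , σ ⇓ υ in-time suc (cost d + cost e) + s + t

  while-false : ∀ {d e P σ} →
    ⟦ e ⟧ σ ≤ ⟦ d ⟧ σ →
    while< d e P , σ ⇓ σ in-time suc (cost d + cost e)

------------------------------------------------------------------------
-- Decision problems and running time

record Problem : Set₁ where
  field
    Input  : Set
    encode : Input → List ℕ
    Yes    : Input → Set

nth : List ℕ → ℕ → ℕ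
nth []       _       = 0
nth (x ∷ _)  zero    = x
nth (_ ∷ xs) (suc i) = nth xs i

-- The input is in array 0, one number per cell; all other memory is 0.
initial : List ℕ → State
initial xs = state (λ _ → 0) (update (λ _ _ → 0) 0 (nth xs))

-- One program, with one constant, halts on every input within the time
-- bound; it answers in variable 0, where 1 means yes.
SolvableInTimeO : (Q : Problem) → (Problem.Input Q → ℕ) → Set
SolvableInTimeO Q T =
  ∃[ P ] ∃[ C ] ∀ I → ∃[ τ ] ∃[ t ]
    (P , initial (encode I) ⇓ τ in-time t)
    × t ≤ C * T I
    × (vars τ 0 ≡ 1 ⇔ Yes I)
  where open Problem Q

elements : ∀ {n} → Subset n → List ℕ
elements {n} p = List.map toℕ (filter (_∈? p) (allFin n))

-- n, m, k, the capacities, and then each set as its size followed by its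
-- elements (numbered from 0).
encodeInstance : Instance → List ℕ
encodeInstance I =
  n ∷ m ∷ k ∷ List.tabulate cap
    ++ concatMap (λ j → ∣ F j ∣ ∷ elements (F j)) (allFin m)
  where open Instance I

SetCoverWithCapacities : Problem
SetCoverWithCapacities = record
  { Input  = Instance
  ; encode = encodeInstance
  ; Yes    = Instance.Solvable
  }

-- (n + m) · (s-max · o-max) ^ k.  Since no algorithm runs in zero steps, each
-- base is read as 1 when it is 0, which happens only if all sets are empty.
timeBound : Instance → ℕ
timeBound I = (1 ⊔ (n + m)) * (1 ⊔ (s-max * o-max)) ^ k
  where open Instance I

-- Breadth-first search over the feasible subfamilies T of size 0, 1, …, k.
-- Given T, choose any set s that still fits.  If T extends to a solution S,
-- then it does so through s or through a set meeting s: when no set of S ∖ T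
-- meets s, one of them can be exchanged for s.  So T has at most
-- b = 1 ⊔ s-max · o-max children, and they are found by a constant number of
-- passes over the input, in time O((n + m) · b).  Level r has at most b ^ r
-- members, hence the total is O((n + m) · Σ_{1 ≤ r ≤ k} b ^ r), which is
-- geometric once b ≥ 2.  If the whole family respects the capacities, every k
-- of its members form a solution; otherwise some element lies in two sets
-- (capacities are positive) and b ≥ 2.
module Submission where

open import Defs
open import Data.Bool using (Bool; true; false; T; _∧_; _∨_; if_then_else_)
open import Data.Bool.Properties using (∨-conicalˡ; ∨-conicalʳ)
open import Data.Empty using (⊥-elim)
open import Data.Fin using (Fin; toℕ; zero; suc)
import Data.Fin.Properties as Finₚ
open import Data.Fin.Subset as Subset
  using (Subset; inside; outside; _∈_; _∉_; _⊆_; ∣_∣; _∩_)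
open import Data.Fin.Subset.Properties
  using ( _∈?_; ∉⊥; ∈⊤; p⊆q⇒∣p∣≤∣q∣; ∣p∣≤n; nonempty?; Empty-unique; ∣⊥∣≡0
        ; x∈p∩q⁺; x∈p∩q⁻; ∣p∩q∣≤∣q∣; ∣p∩q∣≤∣p∣)
open import Data.List as List
  using (List; []; _∷_; _++_; length; map; allFin; filter; concatMap)
open import Data.List.Properties
  using ( length-tabulate; map-tabulate; length-map; length-++; ++-identityʳ; ++-assoc
        ; concatMap-++; filter-accept; filter-reject)
import Data.List.Membership.Propositional as Mem
open import Data.List.Membership.Propositional.Properties
  using (∈-filter⁺; ∈-filter⁻; ∈-allFin; ∈-map⁺)
open import Data.List.Relation.Unary.All as All using (All; []; _∷_)
import Data.List.Relation.Unary.All.Properties as Allₚ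
open import Data.List.Relation.Unary.Any as Any using (Any; here; there)
import Data.List.Relation.Unary.Any.Properties as Anyₚ
open import Data.Nat
  using (ℕ; zero; suc; pred; _+_; _*_; _^_; _⊔_; _≤_; _<_; z≤n; s≤s; _≡ᵇ_; _≟_; _≤?_; _<?_; >-nonZero)
open import Data.Nat.ListAction using (sum)
open import Data.Nat.Properties hiding (_≟_)
open import Data.Nat.Solver using (module +-*-Solver)
open import Data.Product using (_×_; _,_; proj₁; proj₂; ∃-syntax)
open import Data.Sum as Sum using (_⊎_; inj₁; inj₂)
open import Data.Unit using (⊤; tt)
open import Data.Vec using ([]; _∷_; lookup) renaming (_[_]≔_ to _[_:=_])
open import Data.Vec.Functional using (foldr)
open import Data.Vec.Properties
  using ( lookup∘tabulate; lookup-zipWith; []=⇒lookup; lookup⇒[]=; lookup∘update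
        ; lookup∘update′; lookup-replicate)
open import Function using (_∘_; id)
open import Function.Bundles using (_⇔_; mk⇔; Equivalence)
open import Level using (Level)
open import Relation.Nullary using (Dec; yes; no; does; ¬_; contradiction)
open import Relation.Nullary.Decidable using (_×-dec_; _⊎-dec_; ¬?; dec-true; dec-false)
open import Relation.Unary using (Pred; Decidable)
open import Relation.Binary.PropositionalEquality
  using (_≡_; _≢_; refl; sym; trans; cong; cong₂; subst; subst₂; module ≡-Reasoning)
open +-*-Solver using (solve; con; _:+_; _:*_) renaming (_:=_ to _:≡_)

-- Programs with bounded running time

-- The overview leaves the unit of cost implicit. A pass over the input takes time of order
-- `n + m + ∑ⱼ ∣ F j ∣`, which may exceed `n + m`; since `∣ F j ∣ ≤ b`, it is still bounded by a
-- multiple of `(n + m) * b`. Writing out up to `b` children as vectors of length `m` has the same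
-- bound, so the cost of a level can be charged to the a priori bound on the size of the next one.
-- Members of size `k` are never expanded, hence the sum stops at `b ^ k`.
--
-- The machine has neither recursion nor addition, which favours a breadth-first search: subfamilies
-- are kept in a queue with a reading and a writing pointer that are only ever incremented, and sets
-- are located by scanning the tape from left to right. A subfamily may be queued several times,
-- once for each order in which it was built up; this is harmless, because it is the number of queue
-- entries that is bounded.

private variable
  A : Set
  a : Level
  N : ℕ
  P R : Program
  σ : State
  c d : ℕ
  Q Q′ : State → Set

∑ : List A → (A → ℕ) → ℕ
∑ xs f = sum (map f xs)

-- A total-correctness triple with a cost bound. The semantics counts steps exactly, but upper
-- bounds are what composes well; preconditions are ordinary hypotheses of the statements that
-- produce a `Run`.
record Run (P : Program) (σ : State) (c : ℕ) (Q : State → Set) : Set where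
  constructor ran
  field
    {final} : State
    {steps} : ℕ
    exec    : P , σ ⇓ final in-time steps
    bound   : steps ≤ c
    holds   : Q final

open Run public

weaken : c ≤ d → Run P σ c Q → Run P σ d Q
weaken c≤d (ran r b h) = ran r (≤-trans b c≤d) h

infixl 1 _▷_

_▷_ : Run P σ c Q → (∀ {τ} → Q τ → Q′ τ) → Run P σ c Q′
ran r b h ▷ f = ran r b (f h)

run-≔ : ∀ {x e} → Q (setVar x (⟦ e ⟧ σ) σ) → Run (x ≔ e) σ (suc (cost e)) Q
run-≔ = ran assign ≤-refl

run-[]≔ : ∀ {a d e} → Q (setCell a (⟦ d ⟧ σ) (⟦ e ⟧ σ) σ) →
  Run (a [ d ]≔ e) σ (suc (cost d + cost e)) Q
run-[]≔ = ran store ≤-refl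

infixr 0 _then_

_then_ : Run P σ c Q′ → (∀ {τ} → Q′ τ → Run R τ d Q) → Run (P ⨾ R) σ (c + d) Q
ran r b h then f with f h
... | ran r′ b′ h′ = ran (seq r r′) (+-mono-≤ b b′) h′

-- Unlike `_then_`, which forgets the intermediate state, this continues in the updated state
-- itself, so that later reads of concrete variables evaluate by computation.
≔-then : ∀ {x e} → Run R (setVar x (⟦ e ⟧ σ) σ) c Q →
  Run (x ≔ e ⨾ R) σ (suc (cost e) + c) Q
≔-then (ran r b h) = ran (seq assign r) (+-monoʳ-≤ _ b) h

[]≔-then : ∀ {a d e} → Run R (setCell a (⟦ d ⟧ σ) (⟦ e ⟧ σ) σ) c Q →
  Run (a [ d ]≔ e ⨾ R) σ (suc (cost d + cost e) + c) Q
[]≔-then (ran r b h) = ran (seq store r) (+-monoʳ-≤ _ b) h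

run-if : ∀ {u v} →
  (⟦ u ⟧ σ < ⟦ v ⟧ σ → Run P σ c Q) →
  (⟦ v ⟧ σ ≤ ⟦ u ⟧ σ → Run R σ d Q) →
  Run (if< u v P R) σ (suc (cost u + cost v) + (c ⊔ d)) Q
run-if {σ = σ} {c = c} {d = d} {u = u} {v} p q with ⟦ u ⟧ σ <? ⟦ v ⟧ σ
... | yes u<v with p u<v
...   | ran r b h = ran (if-true u<v r) (+-monoʳ-≤ _ (≤-trans b (m≤m⊔n c d))) h
run-if {σ = σ} {c = c} {d = d} {u = u} {v} p q | no u≮v with q (≮⇒≥ u≮v)
...   | ran r b h = ran (if-false (≮⇒≥ u≮v) r) (+-monoʳ-≤ _ (≤-trans b (m≤n⊔m c d))) h

-- The frame rule

writesVar : Program → ℕ → Bool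
writesVar (x ≔ _)        y = x ≡ᵇ y
writesVar (_ [ _ ]≔ _)   y = false
writesVar (P ⨾ R)        y = writesVar P y ∨ writesVar R y
writesVar (if< _ _ P R)  y = writesVar P y ∨ writesVar R y
writesVar (while< _ _ P) y = writesVar P y

writesArray : Program → ℕ → Bool
writesArray (_ ≔ _)        b = false
writesArray (a [ _ ]≔ _)   b = a ≡ᵇ b
writesArray (P ⨾ R)        b = writesArray P b ∨ writesArray R b
writesArray (if< _ _ P R)  b = writesArray P b ∨ writesArray R b
writesArray (while< _ _ P) b = writesArray P b

record Same (P : Program) (σ τ : State) : Set where
  constructor same
  field
    sameVar   : ∀ y → writesVar P y ≡ false → vars τ y ≡ vars σ y
    sameArray : ∀ b → writesArray P b ≡ false → arrays τ b ≡ arrays σ b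

open Same public

same-refl : Same P σ σ
same-refl = same (λ _ _ → refl) (λ _ _ → refl)

update-other : ∀ (f : ℕ → A) x v y → (x ≡ᵇ y) ≡ false → update f x v y ≡ f y
update-other f x v y x≢y = cong (if_then v else f y) x≢y

-- `writesVar` and `writesArray` over-approximate the writes syntactically. For a concrete program
-- and a concrete name they reduce to `false`, so the side condition of a frame step is then `refl`.
exec⇒same : ∀ {P σ τ t} → P , σ ⇓ τ in-time t → Same P σ τ
exec⇒same (assign {x} {e} {σ}) = same (λ y → update-other (vars σ) x _ y) (λ _ _ → refl)
exec⇒same (store {a} {d} {e} {σ}) = same (λ _ _ → refl) (λ b → update-other (arrays σ) a _ b)
exec⇒same (seq {P} r s) with exec⇒same r | exec⇒same s
... | same v a | same v′ a′ = same
  (λ y w → trans (v′ y (∨-conicalʳ (writesVar P y) _ w)) (v y (∨-conicalˡ _ _ w)))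
  (λ b w → trans (a′ b (∨-conicalʳ (writesArray P b) _ w)) (a b (∨-conicalˡ _ _ w)))
exec⇒same (if-true {P = P} _ r) with exec⇒same r
... | same v a = same (λ y w → v y (∨-conicalˡ _ _ w)) (λ b w → a b (∨-conicalˡ _ _ w))
exec⇒same (if-false {P = P} _ r) with exec⇒same r
... | same v a = same (λ y w → v y (∨-conicalʳ (writesVar P y) _ w))
                      (λ b w → a b (∨-conicalʳ (writesArray P b) _ w))
exec⇒same (while-true _ r s) with exec⇒same r | exec⇒same s
... | same v a | same v′ a′ =
  same (λ y w → trans (v′ y w) (v y w)) (λ b w → trans (a′ b w) (a b w))
exec⇒same (while-false _) = same-refl

framed : Run P σ c Q → Run P σ c (λ τ → Same P σ τ × Q τ)
framed (ran r b h) = ran r b (exec⇒same r , h)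

-- Counted loops

while-step : ∀ {u v} → ⟦ u ⟧ σ < ⟦ v ⟧ σ →
  Run P σ c Q′ → (∀ {τ} → Q′ τ → Run (while< u v P) τ d Q) →
  Run (while< u v P) σ (suc (cost u + cost v) + c + d) Q
while-step u<v (ran r b h) next with next h
... | ran r′ b′ h′ = ran (while-true u<v r r′) (+-mono-≤ (+-monoʳ-≤ _ b) b′) h′

-- The list is a ghost variable holding the items still to be treated, and the counter only has to
-- equal its length. Termination thereby becomes structural recursion, and items may differ in cost.
-- Each 3 is the cost of the guard, which is evaluated once more on exit.
while-run : ∀ {c body} (Inv : List A → State → Set) (f : A → ℕ) →
  (∀ {xs σ} → Inv xs σ → vars σ c ≡ length xs) →
  (∀ {x xs σ} → Inv (x ∷ xs) σ → Run body σ (f x) (Inv xs)) →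
  ∀ xs {σ} → Inv xs σ →
  Run (while< (lit 0) (var c) body) σ (3 + ∑ xs (λ x → 3 + f x)) (Inv [])
while-run Inv f len step [] inv =
  ran (while-false (≤-reflexive (len inv))) (s≤s (s≤s (s≤s z≤n))) inv
while-run Inv f len step (x ∷ xs) inv =
  weaken (≤-reflexive (trans (sym (+-assoc (3 + f x) 3 S)) (cong (_+ S) (+-comm (3 + f x) 3))))
    (while-step (subst (0 <_) (sym (len inv)) (s≤s z≤n)) (step inv) (while-run Inv f len step xs))
  where S = ∑ xs (λ x → 3 + f x)

for : ℕ → ℕ → Expr → Program → Program
for i c N body =
  i ≔ lit 0 ⨾ c ≔ N ⨾
  while< (lit 0) (var c) (body ⨾ i ≔ suc-of (var i) ⨾ c ≔ pred-of (var c))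

-- This is what lets `for-run` identify the value of the index variable with the head of the ghost
-- list.
Consecutive : ∀ {n} → ℕ → List (Fin n) → Set
Consecutive a []       = ⊤
Consecutive a (j ∷ js) = a ≡ toℕ j × Consecutive (suc a) js

tabulate-consecutive : ∀ {n k} (f : Fin k → Fin n) a → (∀ j → a + toℕ j ≡ toℕ (f j)) →
  Consecutive a (List.tabulate f)
tabulate-consecutive {k = zero}  f a eq = tt
tabulate-consecutive {k = suc k} f a eq =
  trans (sym (+-identityʳ a)) (eq zero) ,
  tabulate-consecutive (f ∘ suc) (suc a) λ j → trans (sym (+-suc a (toℕ j))) (eq (suc j))

setVar-at : ∀ x v σ → vars (setVar x v σ) x ≡ v
setVar-at x v σ = cong (if_then v else vars σ x) (x≡ᵇx x)
  where
  x≡ᵇx : ∀ x → (x ≡ᵇ x) ≡ true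
  x≡ᵇx zero    = refl
  x≡ᵇx (suc x) = x≡ᵇx x

setVar-off : ∀ x v σ y → (x ≡ᵇ y) ≡ false → vars (setVar x v σ) y ≡ vars σ y
setVar-off x v σ = update-other (vars σ) x v

-- The loop overwrites its index and its counter, so the invariant must survive arbitrary values
-- there; an invariant about other concrete variables does so definitionally. Setup and exit cost
-- `6 + cost N`; the guard and the two updates cost 9 per iteration.
for-run : ∀ {i c N body n σ} (Inv : List (Fin n) → State → Set) (f : Fin n → ℕ) →
  writesVar body i ≡ false → writesVar body c ≡ false → (i ≡ᵇ c) ≡ false → (c ≡ᵇ i) ≡ false →
  (∀ {js σ u v} → Inv js σ → Inv js (setVar c u (setVar i v σ))) →
  ⟦ N ⟧ (setVar i 0 σ) ≡ n →
  (∀ {j js τ} → Inv (j ∷ js) τ → vars τ i ≡ toℕ j → Run body τ (f j) (Inv js)) →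
  Inv (allFin n) σ →
  Run (for i c N body) σ (6 + (cost N + ∑ (allFin n) (λ j → 3 + (f j + 6)))) (Inv [])
for-run {i} {c} {N} {body} {n} {σ} Inv f wi wc i≢c c≢i stable ⟦N⟧≡n step inv =
  weaken (≤-reflexive (cong (3 +_) (trans (+-suc (cost N) _)
    (cong suc (trans (+-suc (cost N) _) (cong suc (+-suc (cost N) _)))))))
  (≔-then (≔-then (while-run Inv′ (λ j → f j + 6) proj₁ step′ (allFin n)
    ( trans (setVar-at c _ σ₁) (trans ⟦N⟧≡n (sym (length-tabulate {n = n} id)))
    , subst (λ a → Consecutive a (allFin n))
        (sym (trans (setVar-off c _ σ₁ i c≢i) (setVar-at i 0 σ)))
        (tabulate-consecutive id 0 (λ _ → refl))
    , stable inv)))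
  ▷ λ (_ , _ , inv) → inv)
  where
  σ₁ = setVar i 0 σ

  Inv′ : List (Fin n) → State → Set
  Inv′ js τ = vars τ c ≡ length js × Consecutive (vars τ i) js × Inv js τ

  step′ : ∀ {j js τ} → Inv′ (j ∷ js) τ →
    Run (body ⨾ i ≔ suc-of (var i) ⨾ c ≔ pred-of (var c)) τ (f j + 6) (Inv′ js)
  step′ {j} {js} (len , (i≡j , consecutive) , inv) =
    framed (step inv i≡j) then λ {υ} (sm , h) →
    let υ₁ = setVar i (suc (vars υ i)) υ in
    ≔-then (run-≔
      ( trans (setVar-at c _ υ₁) (trans (cong pred (setVar-off i _ υ c i≢c))
          (cong pred (trans (sameVar sm c wc) len)))
      , subst (λ a → Consecutive a js)
          (sym (trans (setVar-off c _ υ₁ i c≢i)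
            (trans (setVar-at i _ υ) (cong suc (trans (sameVar sm i wi) i≡j)))))
          (subst (λ a → Consecutive (suc a) js) i≡j consecutive)
      , stable h))

bit : Bool → ℕ
bit true  = 1
bit false = 0

-- Finite sums and cardinalities

∑-cong : ∀ {f g : A → ℕ} → (∀ x → f x ≡ g x) → ∀ xs → ∑ xs f ≡ ∑ xs g
∑-cong eq []       = refl
∑-cong eq (x ∷ xs) = cong₂ _+_ (eq x) (∑-cong eq xs)

∑-mono : ∀ {f g : A → ℕ} → (∀ x → f x ≤ g x) → ∀ xs → ∑ xs f ≤ ∑ xs g
∑-mono le []       = z≤n
∑-mono le (x ∷ xs) = +-mono-≤ (le x) (∑-mono le xs)

∑-const : ∀ (xs : List A) c → ∑ xs (λ _ → c) ≡ length xs * c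
∑-const []       c = refl
∑-const (x ∷ xs) c = cong (c +_) (∑-const xs c)

+-interchange : ∀ a b c d → (a + b) + (c + d) ≡ (a + c) + (b + d)
+-interchange a b c d = begin
  (a + b) + (c + d) ≡⟨ +-assoc a b (c + d) ⟩
  a + (b + (c + d)) ≡⟨ cong (a +_) (sym (+-assoc b c d)) ⟩
  a + ((b + c) + d) ≡⟨ cong (λ e → a + (e + d)) (+-comm b c) ⟩
  a + ((c + b) + d) ≡⟨ cong (a +_) (+-assoc c b d) ⟩
  a + (c + (b + d)) ≡⟨ sym (+-assoc a c (b + d)) ⟩
  (a + c) + (b + d) ∎
  where open ≡-Reasoning

∑-+ : ∀ (f g : A → ℕ) xs → ∑ xs (λ x → f x + g x) ≡ ∑ xs f + ∑ xs g
∑-+ f g []       = refl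
∑-+ f g (x ∷ xs) = trans (cong (f x + g x +_) (∑-+ f g xs)) (+-interchange (f x) (g x) _ _)

∑-swap : ∀ {B : Set} (f : A → B → ℕ) xs ys →
  ∑ xs (λ x → ∑ ys (f x)) ≡ ∑ ys (λ y → ∑ xs (λ x → f x y))
∑-swap f []       ys = sym (trans (∑-const ys 0) (*-zeroʳ (length ys)))
∑-swap f (x ∷ xs) ys =
  trans (cong (∑ ys (f x) +_) (∑-swap f xs ys)) (sym (∑-+ (f x) _ ys))

∑-allFin : ∀ (f : Fin N → ℕ) → ∑ (allFin N) f ≡ List.foldr _+_ 0 (List.tabulate f)
∑-allFin f = cong (List.foldr _+_ 0) (map-tabulate id f)

∑-allFin-suc : ∀ (f : Fin (suc N) → ℕ) → ∑ (allFin (suc N)) f ≡ f zero + ∑ (allFin N) (f ∘ suc)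
∑-allFin-suc f = trans (∑-allFin f) (cong (f zero +_) (sym (∑-allFin (f ∘ suc))))

≤-∑ : ∀ (f : A → ℕ) {x xs} → x Mem.∈ xs → f x ≤ ∑ xs f
≤-∑ f (here refl) = m≤m+n _ _
≤-∑ f (there x∈)  = ≤-trans (≤-∑ f x∈) (m≤n+m _ _)

∑-lookup : ∀ (p : Subset N) → ∑ (allFin N) (bit ∘ lookup p) ≡ ∣ p ∣
∑-lookup []            = refl
∑-lookup p@(true  ∷ q) = trans (∑-allFin-suc (bit ∘ lookup p)) (cong suc (∑-lookup q))
∑-lookup p@(false ∷ q) = trans (∑-allFin-suc (bit ∘ lookup p)) (∑-lookup q)

length-filter-∑ : ∀ {P : Pred A a} (P? : Decidable P) xs →
  length (filter P? xs) ≡ ∑ xs (λ x → bit (does (P? x)))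
length-filter-∑ P? []       = refl
length-filter-∑ P? (x ∷ xs) with does (P? x)
... | true  = cong suc (length-filter-∑ P? xs)
... | false = length-filter-∑ P? xs

does-∈? : ∀ i (p : Subset N) → does (i ∈? p) ≡ lookup p i
does-∈? zero    (true  ∷ p) = refl
does-∈? zero    (false ∷ p) = refl
does-∈? (suc i) (_     ∷ p) = does-∈? i p

-- A multiplicity rather than a membership test: the loop that computes loads adds one for each
-- occurrence it reads, so it matters that `members j` lists every element exactly once.
hits : Fin N → List (Fin N) → ℕ
hits i is = ∑ is (λ i′ → bit (does (i Finₚ.≟ i′)))

hits-allFin : ∀ (i : Fin N) → hits i (allFin N) ≡ 1
hits-allFin {N = suc N} zero    = trans (∑-allFin-suc {N = N} (λ i′ → bit (does (zero {N} Finₚ.≟ i′))))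
  (cong suc (trans (∑-const (allFin N) 0) (*-zeroʳ (length (allFin N)))))
hits-allFin {N = suc N} (suc i) = trans (∑-allFin-suc (λ i′ → bit (does (suc i Finₚ.≟ i′)))) (hits-allFin i)

hits-filter : ∀ {P : Pred (Fin N) a} (P? : Decidable P) i is →
  hits i (filter P? is) ≡ bit (does (P? i)) * hits i is
hits-filter P? i [] = sym (*-zeroʳ (bit (does (P? i))))
hits-filter P? i (i′ ∷ is) with i Finₚ.≟ i′
... | yes refl with does (P? i) in eq
...   | true rewrite dec-true (i Finₚ.≟ i) refl =
        cong suc (trans (hits-filter P? i is) (cong (λ b → bit b * hits i is) eq))
...   | false = trans (hits-filter P? i is) (cong (λ b → bit b * hits i is) eq)
hits-filter P? i (i′ ∷ is) | no i≢i′ with does (P? i′)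
...   | true rewrite dec-false (i Finₚ.≟ i′) i≢i′ = hits-filter P? i is
...   | false = hits-filter P? i is

∣[]≔inside∩∣ : ∀ (p q : Subset N) j → lookup p j ≡ false →
  ∣ (p [ j := inside ]) ∩ q ∣ ≡ bit (lookup q j) + ∣ p ∩ q ∣
∣[]≔inside∩∣ (false ∷ p) (true  ∷ q) zero    refl = refl
∣[]≔inside∩∣ (false ∷ p) (false ∷ q) zero    refl = refl
∣[]≔inside∩∣ (true  ∷ p) (true  ∷ q) (suc j) eq   =
  trans (cong suc (∣[]≔inside∩∣ p q j eq)) (sym (+-suc (bit (lookup q j)) _))
∣[]≔inside∩∣ (true  ∷ p) (false ∷ q) (suc j) eq   = ∣[]≔inside∩∣ p q j eq
∣[]≔inside∩∣ (false ∷ p) (true  ∷ q) (suc j) eq   = ∣[]≔inside∩∣ p q j eq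
∣[]≔inside∩∣ (false ∷ p) (false ∷ q) (suc j) eq   = ∣[]≔inside∩∣ p q j eq

∣[]≔inside∣ : ∀ (p : Subset N) j → lookup p j ≡ false → ∣ p [ j := inside ] ∣ ≡ suc ∣ p ∣
∣[]≔inside∣ (false ∷ p) zero    refl = refl
∣[]≔inside∣ (true  ∷ p) (suc j) eq   = cong suc (∣[]≔inside∣ p j eq)
∣[]≔inside∣ (false ∷ p) (suc j) eq   = ∣[]≔inside∣ p j eq

∣[]≔outside∣ : ∀ (p : Subset N) j → lookup p j ≡ true → suc ∣ p [ j := outside ] ∣ ≡ ∣ p ∣
∣[]≔outside∣ (true  ∷ p) zero    refl = refl
∣[]≔outside∣ (true  ∷ p) (suc j) eq   = cong suc (∣[]≔outside∣ p j eq)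
∣[]≔outside∣ (false ∷ p) (suc j) eq   = ∣[]≔outside∣ p j eq

∉⇒lookup : ∀ {j} {p : Subset N} → j ∉ p → lookup p j ≡ false
∉⇒lookup {j = j} {p} j∉p with lookup p j in eq
... | true  = contradiction (lookup⇒[]= j p eq) j∉p
... | false = refl

∈-[]≔⁻ : ∀ {p : Subset N} {i j} → i ∈ (p [ j := inside ]) → i ≡ j ⊎ i ∈ p
∈-[]≔⁻ {p = p} {i} {j} i∈ with i Finₚ.≟ j
... | yes i≡j = inj₁ i≡j
... | no  i≢j = inj₂ (lookup⇒[]= i p (trans (sym (lookup∘update′ i≢j p inside)) ([]=⇒lookup i∈)))

∈-[]≔⁺ : ∀ {p : Subset N} {i j} → i ∈ p → i ∈ (p [ j := inside ])
∈-[]≔⁺ {p = p} {i} {j} i∈p with i Finₚ.≟ j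
... | yes refl = lookup⇒[]= i _ (lookup∘update i p inside)
... | no  i≢j  = lookup⇒[]= i _ (trans (lookup∘update′ i≢j p inside) ([]=⇒lookup i∈p))

∈-remove⁻ : ∀ {p : Subset N} {i j} → i ∈ (p [ j := outside ]) → i ∈ p
∈-remove⁻ {p = p} {i} {j} i∈ with i Finₚ.≟ j
... | yes refl = contradiction (trans (sym ([]=⇒lookup i∈)) (lookup∘update i p outside)) λ ()
... | no  i≢j  = lookup⇒[]= i p (trans (sym (lookup∘update′ i≢j p outside)) ([]=⇒lookup i∈))

∈-remove⁺ : ∀ {p : Subset N} {i j} → i ∈ p → i ≢ j → i ∈ (p [ j := outside ])
∈-remove⁺ {p = p} {i} i∈p i≢j = lookup⇒[]= i _ (trans (lookup∘update′ i≢j p outside) ([]=⇒lookup i∈p))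

∩-monoˡ : ∀ {p p′ : Subset N} q → p ⊆ p′ → ∣ p ∩ q ∣ ≤ ∣ p′ ∩ q ∣
∩-monoˡ {p = p} q p⊆p′ = p⊆q⇒∣p∣≤∣q∣ λ i∈ →
  x∈p∩q⁺ (p⊆p′ (proj₁ (x∈p∩q⁻ p q i∈)) , proj₂ (x∈p∩q⁻ p q i∈))

⊔-upper : ∀ (f : Fin N → ℕ) i → f i ≤ foldr _⊔_ 0 f
⊔-upper f zero    = m≤m⊔n _ _
⊔-upper f (suc i) = ≤-trans (⊔-upper (f ∘ suc) i) (m≤n⊔m (f zero) _)

nonempty⇒1≤ : ∀ {p : Subset N} {i} → i ∈ p → 1 ≤ ∣ p ∣
nonempty⇒1≤ {p = p} {i} i∈p = ≤-trans
  (≤-reflexive (sym (cong bit ([]=⇒lookup i∈p))))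
  (≤-trans (≤-∑ (bit ∘ lookup p) (∈-allFin i)) (≤-reflexive (∑-lookup p)))

firsts : ∀ k {m} → k ≤ m → ∃[ S ] ∣_∣ {m} S ≡ k
firsts zero    {m} _         = Subset.⊥ , ∣⊥∣≡0 m
firsts (suc k) (s≤s k≤m) with firsts k k≤m
... | S , eq = true ∷ S , cong suc eq

-- Branching on a set that fits

module Family (I : Instance) where
  open Instance I

  members : Fin m → List (Fin n)
  members j = filter (_∈? F j) (allFin n)

  load : Subset m → Fin n → ℕ
  load T i = ∣ T ∩ occurrences i ∣

  lookup-occurrences : ∀ i j → lookup (occurrences i) j ≡ lookup (F j) i
  lookup-occurrences i j = lookup∘tabulate _ j

  length-members : ∀ j → length (members j) ≡ ∣ F j ∣
  length-members j = trans (length-filter-∑ (_∈? F j) (allFin n))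
    (trans (∑-cong (λ i → cong bit (does-∈? i (F j))) (allFin n)) (∑-lookup (F j)))

  hits-members : ∀ i j → hits i (members j) ≡ bit (lookup (F j) i)
  hits-members i j = trans (hits-filter (_∈? F j) i (allFin n))
    (trans (cong₂ _*_ (cong bit (does-∈? i (F j))) (hits-allFin i)) (*-identityʳ _))

  ∈-members⁺ : ∀ {i j} → i ∈ F j → i Mem.∈ members j
  ∈-members⁺ i∈ = ∈-filter⁺ (_∈? _) (∈-allFin _) i∈

  ∈-members⁻ : ∀ {i j} → i Mem.∈ members j → i ∈ F j
  ∈-members⁻ i∈ = proj₂ (∈-filter⁻ (_∈? _) {xs = allFin n} i∈)

  load-∑ : ∀ T i → ∑ (allFin m) (λ j → bit (lookup T j) * bit (lookup (F j) i)) ≡ load T i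
  load-∑ T i = trans (∑-cong pointwise (allFin m)) (∑-lookup (T ∩ occurrences i))
    where
    bit-∧ : ∀ x y → bit x * bit y ≡ bit (x ∧ y)
    bit-∧ true  y = +-identityʳ (bit y)
    bit-∧ false y = refl
    pointwise : ∀ j → bit (lookup T j) * bit (lookup (F j) i) ≡ bit (lookup (T ∩ occurrences i) j)
    pointwise j = trans (bit-∧ (lookup T j) _) (cong bit (sym
      (trans (lookup-zipWith _∧_ j T (occurrences i)) (cong (lookup T j ∧_) (lookup-occurrences i j)))))

  Feasible : Subset m → Set
  Feasible T = ∀ i → load T i ≤ cap i

  Blocked : Subset m → Fin m → Set
  Blocked T j = j ∈ T ⊎ Any (λ i → cap i ≤ load T i) (members j)

  Blocked? : ∀ T → Decidable (Blocked T)
  Blocked? T j = (j ∈? T) ⊎-dec Any.any? (λ i → cap i ≤? load T i) (members j)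

  -- The first disjunct matters when `F s` is empty: then `s` meets no set, not even itself, and yet
  -- it must be offered as a branch.
  Close : Fin m → Fin m → Set
  Close s j = s ≡ j ⊎ Any (_∈ F s) (members j)

  Close? : ∀ s → Decidable (Close s)
  Close? s j = (s Finₚ.≟ j) ⊎-dec Any.any? (_∈? F s) (members j)

  Branch : Subset m → Fin m → Fin m → Set
  Branch T s j = ¬ Blocked T j × Close s j

  Branch? : ∀ T s → Decidable (Branch T s)
  Branch? T s j = ¬? (Blocked? T j) ×-dec Close? s j

  insert : Subset m → Fin m → Subset m
  insert T j = T [ j := inside ]

  children : Subset m → Fin m → List (Subset m)
  children T s = map (insert T) (filter (Branch? T s) (allFin m))

  -- Which unblocked set is branched on is left open, so that the combinatorial argument does not
  -- depend on how the program chooses it.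
  data Expansion (T : Subset m) : List (Subset m) → Set where
    stuck  : (∀ j → Blocked T j) → Expansion T []
    branch : ∀ s → ¬ Blocked T s → Expansion T (children T s)

  load-insert : ∀ {T j} → j ∉ T → ∀ i → load (insert T j) i ≡ bit (lookup (F j) i) + load T i
  load-insert {T} {j} j∉T i = trans (∣[]≔inside∩∣ T (occurrences i) j (∉⇒lookup j∉T))
    (cong (λ b → bit b + load T i) (lookup-occurrences i j))

  load-mono : ∀ {S T} → S ⊆ T → ∀ i → load S i ≤ load T i
  load-mono S⊆T i = ∩-monoˡ (occurrences i) S⊆T

  unblocked : ∀ {T j} → ¬ Blocked T j → j ∉ T × (∀ {i} → i ∈ F j → load T i < cap i)
  unblocked ¬bl = (λ j∈ → ¬bl (inj₁ j∈)) ,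
    (λ i∈ → ≰⇒> λ le → ¬bl (inj₂ (Mem.lose (∈-members⁺ i∈) le)))

  bound-insert : ∀ {T j} → j ∉ T → (∀ {i} → i ∈ F j → load T i < cap i) → Feasible T → Feasible (insert T j)
  bound-insert {T} {j} j∉T room feas i with lookup (F j) i in eq
  ... | true  = ≤-trans (≤-reflexive (trans (load-insert j∉T i) (cong (λ b → bit b + load T i) eq)))
                        (room (lookup⇒[]= i (F j) eq))
  ... | false = ≤-trans (≤-reflexive (trans (load-insert j∉T i) (cong (λ b → bit b + load T i) eq))) (feas i)

  Solution : Subset m → Set
  Solution S = ∣ S ∣ ≡ k × Feasible S

  Extendable : Subset m → Set
  Extendable T = ∃[ S ] Solution S × T ⊆ S

  insert-⊆ : ∀ {S T j} → T ⊆ S → j ∈ S → insert T j ⊆ S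
  insert-⊆ T⊆S j∈S i∈ with ∈-[]≔⁻ i∈
  ... | inj₁ refl = j∈S
  ... | inj₂ i∈T  = T⊆S i∈T

  -- If an element of `F j` were full under `T`, then `insert T j` would overload it, and so would
  -- the larger family `S`.
  extra-unblocked : ∀ {S T j} → Feasible S → T ⊆ S → j ∈ S → j ∉ T → ¬ Blocked T j
  extra-unblocked feas T⊆S j∈S j∉T (inj₁ j∈T) = j∉T j∈T
  extra-unblocked {S} {T} {j} feas T⊆S j∈S j∉T (inj₂ full) with Mem.find full
  ... | i , i∈ , cap≤ = <-irrefl refl (begin-strict
    load T i            <⟨ ≤-refl ⟩
    suc (load T i)      ≡⟨ cong (λ b → bit b + load T i) (sym ([]=⇒lookup (∈-members⁻ i∈))) ⟩
    bit (lookup (F j) i) + load T i ≡⟨ sym (load-insert j∉T i) ⟩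
    load (insert T j) i ≤⟨ load-mono (insert-⊆ T⊆S j∈S) i ⟩
    load S i            ≤⟨ feas i ⟩
    cap i               ≤⟨ cap≤ ⟩
    load T i            ∎)
    where open ≤-Reasoning

  missing : ∀ {S T : Subset m} → ∣ T ∣ < ∣ S ∣ → ∃[ x ] x ∈ S × x ∉ T
  missing {S} {T} lt with Finₚ.any? (λ x → (x ∈? S) ×-dec ¬? (x ∈? T))
  ... | yes found = found
  ... | no  none  = contradiction (p⊆q⇒∣p∣≤∣q∣ S⊆T) (<⇒≱ lt)
    where
    S⊆T : S ⊆ T
    S⊆T {x} x∈S with x ∈? T
    ... | yes x∈T = x∈T
    ... | no  x∉T = contradiction (x , x∈S , x∉T) none

  -- If nothing in S ∖ T is close to s, then any element of S ∖ T may be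
  -- exchanged for s, because the elements of F s get no load from S ∖ T.
  extension-branches : ∀ {T s} → ¬ Blocked T s → ∣ T ∣ < k → Extendable T →
    ∃[ j ] Branch T s j × Extendable (insert T j)
  extension-branches {T} {s} ¬bl lt (S , (∣S∣≡k , feas) , T⊆S)
    with Finₚ.any? (λ j → (j ∈? S) ×-dec (¬? (j ∈? T) ×-dec Close? s j))
  ... | yes (j , j∈S , j∉T , close) =
        j , (extra-unblocked feas T⊆S j∈S j∉T , close) , S , (∣S∣≡k , feas) , insert-⊆ T⊆S j∈S
  ... | no none with missing {S} {T} (subst (∣ T ∣ <_) (sym ∣S∣≡k) lt)
  ... | x , x∈S , x∉T =
        s , (¬bl , inj₁ refl) , insert S′ s , (card , bound-insert s∉S′ room feas′) , sub
    where
    S′ = S [ x := outside ]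

    s∉S′ : s ∉ S′
    s∉S′ s∈ = none (s , ∈-remove⁻ s∈ , proj₁ (unblocked ¬bl) , inj₁ refl)

    card : ∣ insert S′ s ∣ ≡ k
    card = trans (∣[]≔inside∣ S′ s (∉⇒lookup s∉S′)) (trans (∣[]≔outside∣ S x ([]=⇒lookup x∈S)) ∣S∣≡k)

    feas′ : Feasible S′
    feas′ i = ≤-trans (load-mono {S′} {S} ∈-remove⁻ i) (feas i)

    room : ∀ {i} → i ∈ F s → load S′ i < cap i
    room {i} i∈ = ≤-<-trans (p⊆q⇒∣p∣≤∣q∣ inT) (proj₂ (unblocked ¬bl) i∈)
      where
      inT : (S′ ∩ occurrences i) ⊆ (T ∩ occurrences i)
      inT {j} j∈ with x∈p∩q⁻ S′ (occurrences i) j∈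
      ... | j∈S′ , j∈occ with j ∈? T
      ...   | yes j∈T = x∈p∩q⁺ (j∈T , j∈occ)
      ...   | no  j∉T = contradiction
              (j , ∈-remove⁻ j∈S′ , j∉T , inj₂ (Mem.lose (∈-members⁺ (lookup⇒[]= i (F j)
                 (trans (sym (lookup-occurrences i j)) ([]=⇒lookup j∈occ)))) i∈)) none

    sub : insert T s ⊆ insert S′ s
    sub i∈ with ∈-[]≔⁻ i∈
    ... | inj₁ refl = lookup⇒[]= s _ (lookup∘update s S′ inside)
    ... | inj₂ i∈T  = ∈-[]≔⁺ (∈-remove⁺ (T⊆S i∈T) λ { refl → x∉T i∈T })

  -- Bounding the number of branches

  b : ℕ
  b = 1 ⊔ (s-max * o-max)

  1≤b : 1 ≤ b
  1≤b = m≤m⊔n 1 (s-max * o-max)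

  1≤o-max : ∀ {i j} → i ∈ F j → 1 ≤ o-max
  1≤o-max {i} {j} i∈ = ≤-trans
    (nonempty⇒1≤ {p = occurrences i} {j} (lookup⇒[]= j _ (trans (lookup-occurrences i j) ([]=⇒lookup i∈))))
    (⊔-upper (λ i → ∣ occurrences i ∣) i)

  ∣F∣≤s-max : ∀ j → ∣ F j ∣ ≤ s-max
  ∣F∣≤s-max = ⊔-upper (λ j → ∣ F j ∣)

  -- The product `s-max * o-max` dominates `s-max` only if `o-max` is positive, which any element of
  -- `F j` guarantees; an empty set needs no such help.
  ∣F∣≤b : ∀ j → ∣ F j ∣ ≤ b
  ∣F∣≤b j with nonempty? (F j)
  ... | no  empty = ≤-trans (≤-reflexive (trans (cong ∣_∣ (Empty-unique empty)) (∣⊥∣≡0 n))) z≤n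
  ... | yes (i , i∈) = ≤-trans (∣F∣≤s-max j) (≤-trans
          (≤-trans (≤-reflexive (sym (*-identityʳ s-max))) (*-monoʳ-≤ s-max (1≤o-max i∈))) (m≤n⊔m 1 (s-max * o-max)))

  does-≤ : ∀ {P : Set} (P? : Dec P) {c} → (P → 1 ≤ c) → bit (does P?) ≤ c
  does-≤ (yes p) f = f p
  does-≤ (no _)  f = z≤n

  -- Double counting: a branch `j` contributes a pair `(i , j)` with `i` in both `F s` and `F j`.
  -- There are at most `s-max` choices of `i`, and each lies in at most `o-max` sets. If `F s` is
  -- empty, only `s` itself can be a branch, and the `1` in `b` pays for it.
  length-branches : ∀ T s → length (filter (Branch? T s) (allFin m)) ≤ b
  length-branches T s with nonempty? (F s)
  ... | no empty = begin
    length (filter (Branch? T s) (allFin m))        ≡⟨ length-filter-∑ (Branch? T s) (allFin m) ⟩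
    ∑ (allFin m) (λ j → bit (does (Branch? T s j))) ≤⟨ ∑-mono only (allFin m) ⟩
    hits s (allFin m)                               ≡⟨ hits-allFin s ⟩
    1                                               ≤⟨ 1≤b ⟩
    b ∎
    where
    open ≤-Reasoning
    only : ∀ j → bit (does (Branch? T s j)) ≤ bit (does (s Finₚ.≟ j))
    only j = does-≤ (Branch? T s j) λ
      { (_ , inj₁ s≡j) → ≤-reflexive (cong bit (sym (dec-true (s Finₚ.≟ j) s≡j)))
      ; (_ , inj₂ any) → ⊥-elim (empty (let i , _ , i∈ = Mem.find any in i , i∈)) }
  ... | yes (i₀ , i₀∈) = begin
    length (filter (Branch? T s) (allFin m))        ≡⟨ length-filter-∑ (Branch? T s) (allFin m) ⟩
    ∑ (allFin m) (λ j → bit (does (Branch? T s j))) ≤⟨ ∑-mono shared (allFin m) ⟩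
    ∑ (allFin m) (λ j → ∑ (members s) (λ i → bit (lookup (F j) i))) ≡⟨ ∑-swap _ (allFin m) (members s) ⟩
    ∑ (members s) (λ i → ∑ (allFin m) (λ j → bit (lookup (F j) i))) ≤⟨ ∑-mono few (members s) ⟩
    ∑ (members s) (λ _ → o-max)                     ≡⟨ ∑-const (members s) o-max ⟩
    length (members s) * o-max                      ≡⟨ cong (_* o-max) (length-members s) ⟩
    ∣ F s ∣ * o-max                                 ≤⟨ *-monoˡ-≤ o-max (∣F∣≤s-max s) ⟩
    s-max * o-max                                   ≤⟨ m≤n⊔m 1 (s-max * o-max) ⟩
    b ∎
    where
    open ≤-Reasoning
    common : ∀ {i j} → i ∈ F s → i ∈ F j → 1 ≤ ∑ (members s) (λ i → bit (lookup (F j) i))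
    common {i} {j} i∈s i∈j = ≤-trans (≤-reflexive (sym (cong bit ([]=⇒lookup i∈j))))
      (≤-∑ (λ i → bit (lookup (F j) i)) (∈-members⁺ i∈s))
    shared : ∀ j → bit (does (Branch? T s j)) ≤ ∑ (members s) (λ i → bit (lookup (F j) i))
    shared j = does-≤ (Branch? T s j) λ
      { (_ , inj₁ refl) → common {j = j} i₀∈ i₀∈
      ; (_ , inj₂ any) → let i , i∈j , i∈s = Mem.find any in common {j = j} i∈s (∈-members⁻ {j = j} i∈j) }
    few : ∀ i → ∑ (allFin m) (λ j → bit (lookup (F j) i)) ≤ o-max
    few i = ≤-trans (≤-reflexive (trans
        (∑-cong (λ j → cong bit (sym (lookup-occurrences i j))) (allFin m)) (∑-lookup (occurrences i))))
      (⊔-upper (λ i → ∣ occurrences i ∣) i)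

  length-expansion : ∀ {T ks} → Expansion T ks → length ks ≤ b
  length-expansion (stuck _) = z≤n
  length-expansion {T} (branch s _) =
    ≤-trans (≤-reflexive (length-map (insert T) (filter (Branch? T s) (allFin m)))) (length-branches T s)

  -- The search invariant

  Partial : ℕ → Subset m → Set
  Partial d T = Feasible T × ∣ T ∣ ≡ d

  expansion-sound : ∀ {d T ks} → Partial d T → Expansion T ks → All (Partial (suc d)) ks
  expansion-sound _ (stuck _) = []
  expansion-sound {T = T} (feas , refl) (branch s _) =
    Allₚ.map⁺ (All.map grow (Allₚ.all-filter (Branch? T s) (allFin m)))
    where
    grow : ∀ {j} → Branch T s j → Partial (suc ∣ T ∣) (insert T j)
    grow (¬bl , _) with unblocked ¬bl
    ... | j∉T , room = bound-insert j∉T room feas , ∣[]≔inside∣ T _ (∉⇒lookup j∉T)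

  expansion-complete : ∀ {T ks} → ∣ T ∣ < k → Expansion T ks → Extendable T → Any Extendable ks
  expansion-complete {T} lt (stuck all-blocked) (S , (∣S∣≡k , feas) , T⊆S)
    with missing {S} {T} (subst (_ <_) (sym ∣S∣≡k) lt)
  ... | x , x∈S , x∉T = contradiction (all-blocked x) (extra-unblocked feas T⊆S x∈S x∉T)
  expansion-complete {T} lt (branch s ¬bl) ext with extension-branches ¬bl lt ext
  ... | j , br , ext′ = Mem.lose (∈-map⁺ (insert T) (∈-filter⁺ (Branch? T s) (∈-allFin j) br)) ext′

  ⊥-feasible : Feasible Subset.⊥
  ⊥-feasible i = ≤-trans (∣p∩q∣≤∣p∣ (Subset.⊥ {m}) (occurrences i)) (≤-trans (≤-reflexive (∣⊥∣≡0 m)) z≤n)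

  -- A moment of the breadth-first search: at most N partial solutions of size
  -- d were queued, of which ps are unprocessed; ns are the children of the
  -- processed ones.
  record Stage (d N : ℕ) (ps ns : List (Subset m)) : Set where
    field
      pending  : All (Partial d) ps
      produced : All (Partial (suc d)) ns
      complete : Solvable → Any Extendable ps ⊎ Any Extendable ns
      counted  : length ns + length ps * b ≤ N * b

  open Stage public

  start : Stage 0 1 (Subset.⊥ ∷ []) []
  start = record
    { pending  = (⊥-feasible , ∣⊥∣≡0 m) ∷ []
    ; produced = []
    ; complete = λ { (S , sol) → inj₁ (here (S , sol , λ i∈ → contradiction i∈ ∉⊥)) }
    ; counted  = ≤-refl
    }

  -- `counted` grants each unprocessed member a credit of `b` children in advance, so processing `T`
  -- only exchanges its credit for actual children. The hypothesis `d < k` ensures that `T` still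
  -- lacks a set, without which `expansion-complete` would fail.
  process : ∀ {d N T ps ns ks} → d < k → Stage d N (T ∷ ps) ns → Expansion T ks → Stage d N ps (ns ++ ks)
  process {d} {N} {T} {ps} {ns} {ks} d<k L ex with pending L
  ... | part ∷ parts = record
    { pending  = parts
    ; produced = Allₚ.++⁺ (produced L) (expansion-sound part ex)
    ; complete = λ sol → completeness (complete L sol)
    ; counted  = begin
        length (ns ++ ks) + length ps * b          ≡⟨ cong (_+ length ps * b) (length-++ ns) ⟩
        (length ns + length ks) + length ps * b    ≤⟨ +-monoˡ-≤ _ (+-monoʳ-≤ (length ns) (length-expansion ex)) ⟩
        (length ns + b) + length ps * b            ≡⟨ +-assoc (length ns) b _ ⟩
        length ns + (b + length ps * b)            ≤⟨ counted L ⟩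
        N * b ∎
    }
    where
    open ≤-Reasoning
    completeness : Any Extendable (T ∷ ps) ⊎ Any Extendable ns → Any Extendable ps ⊎ Any Extendable (ns ++ ks)
    completeness (inj₁ (here ext)) = inj₂ (Anyₚ.++⁺ʳ ns (expansion-complete (subst (_< k) (sym (proj₂ part)) d<k) ex ext))
    completeness (inj₁ (there e))  = inj₁ e
    completeness (inj₂ e)          = inj₂ (Anyₚ.++⁺ˡ e)

  descend : ∀ {d N ns} → Stage d N [] ns → Stage (suc d) (N * b) ns []
  descend {N = N} {ns} L = record
    { pending  = produced L
    ; produced = []
    ; complete = λ sol → inj₁ (swap (complete L sol))
    ; counted  = *-monoˡ-≤ b (≤-trans (m≤m+n (length ns) 0) (counted L))
    }
    where
    swap : Any Extendable [] ⊎ Any Extendable ns → Any Extendable ns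
    swap (inj₂ e) = e

  -- At size `k` a partial solution is a solution, so testing whether the queue is nonempty decides
  -- the instance.
  finish : ∀ {N ps} → Stage k N ps [] → 0 < length ps ⇔ Solvable
  finish {ps = ps} L = mk⇔ (to (pending L)) (λ sol → from (complete L sol))
    where
    to : ∀ {ps} → All (Partial k) ps → 0 < length ps → Solvable
    to (_∷_ {T} (feas , card) _) _ = T , card , feas
    from : Any Extendable ps ⊎ Any Extendable [] → 0 < length ps
    from (inj₁ (here _))  = s≤s z≤n
    from (inj₁ (there _)) = s≤s z≤n

  k≡0⇒solvable : k ≡ 0 → Solvable
  k≡0⇒solvable k≡0 = Subset.⊥ , trans (∣⊥∣≡0 m) (sym k≡0) , ⊥-feasible

  m<k⇒unsolvable : m < k → ¬ Solvable
  m<k⇒unsolvable m<k (S , card , _) = <⇒≱ m<k (≤-trans (≤-reflexive (sym card)) (∣p∣≤n S))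

  all-feasible⇒solvable : k ≤ m → Feasible Subset.⊤ → Solvable
  all-feasible⇒solvable k≤m feas with firsts k k≤m
  ... | S , card = S , card , λ i → ≤-trans (load-mono {S} {Subset.⊤} (λ _ → ∈⊤) i) (feas i)

  all-infeasible⇒2≤b : ∀ {i} → cap i < load Subset.⊤ i → 2 ≤ b
  all-infeasible⇒2≤b {i} lt = ≤-trans (*-mono-≤ 1≤s 2≤o) (m≤n⊔m 1 (s-max * o-max))
    where
    2≤occ : 2 ≤ ∣ occurrences i ∣
    2≤occ = ≤-trans (s≤s (1≤cap i)) (≤-trans lt (∣p∩q∣≤∣q∣ (Subset.⊤ {m}) (occurrences i)))
    2≤o : 2 ≤ o-max
    2≤o = ≤-trans 2≤occ (⊔-upper (λ i → ∣ occurrences i ∣) i)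
    1≤s : 1 ≤ s-max
    1≤s with nonempty? (occurrences i)
    ... | no empty = contradiction (≤-trans 2≤occ (≤-reflexive (trans (cong ∣_∣ (Empty-unique empty)) (∣⊥∣≡0 m)))) λ ()
    ... | yes (j , j∈) = ≤-trans
            (nonempty⇒1≤ {p = F j} (lookup⇒[]= i (F j) (trans (sym (lookup-occurrences i j)) ([]=⇒lookup j∈))))
            (∣F∣≤s-max j)

-- The program

-- Arrays.  A subfamily T is stored as its characteristic vector, of length m;
-- the queue is the concatenation of such vectors, mask is the one in process.
input queue mask load# mark : ℕ
input = 0
queue = 1
mask  = 2
load# = 3
mark  = 4

-- Variables.  The language has no skip: where it is wanted, close is
-- overwritten (at a time when its value is irrelevant) or copied onto itself.
answer base ptr todo elem set left blocked found star starPtr from close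
  rd wr current next rounds index count over : ℕ
answer  = 0
base    = 1
ptr     = 2
todo    = 3
elem    = 4
set     = 5
left    = 6
blocked = 7
found   = 8
star    = 9
starPtr = 10
from    = 11
close   = 12
rd      = 13
wr      = 14
current = 15
next    = 16
rounds  = 17
index   = 18
count   = 19
over    = 20

#elements #sets #chosen : Expr
#elements = input [ lit 0 ]
#sets     = input [ lit 1 ]
#chosen   = input [ lit 2 ]

capacity : ℕ → Expr
capacity x = input [ suc-of (suc-of (suc-of (var x))) ]

readSet : Program → Program
readSet body =
  todo ≔ input [ var ptr ] ⨾ ptr ≔ suc-of (var ptr) ⨾
  while< (lit 0) (var todo)
    (elem ≔ input [ var ptr ] ⨾ ptr ≔ suc-of (var ptr) ⨾ todo ≔ pred-of (var todo) ⨾ body)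

scan : Program → Program → Program → Program
scan pre body post =
  ptr ≔ var base ⨾ for set left #sets (pre ⨾ readSet body ⨾ post)

reset : Program
reset = for index count #elements (load# [ var index ]≔ lit 0 ⨾ mark [ var index ]≔ lit 0)

computeLoads : Program
computeLoads = scan (close ≔ lit 0)
  (if< (lit 0) (mask [ var set ]) (load# [ var elem ]≔ suc-of (load# [ var elem ])) (close ≔ lit 0))
  (close ≔ lit 0)

checkElem : Program
checkElem = if< (load# [ var elem ]) (capacity elem) (close ≔ var close) (blocked ≔ lit 1)

-- `readSet` moves `ptr` past the set, so `from` keeps the position of its size field, from which
-- `markStar` later reads the star again. Each fitting set overwrites the previous choice, and the
-- last one wins.
findStar : Program
findStar = scan
  (from ≔ var ptr ⨾ blocked ≔ mask [ var set ])
  checkElem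
  (if< (var blocked) (lit 1)
    (found ≔ lit 1 ⨾ star ≔ var set ⨾ starPtr ≔ var from)
    (close ≔ var close))

markStar : Program
markStar = ptr ≔ var starPtr ⨾ readSet (mark [ var elem ]≔ lit 1)

-- The child differs from `T` in one bit, so that bit of `mask` is set while the vector is copied
-- and cleared afterwards; the rest of the scan again sees `T`.
push : Program
push =
  mask [ var set ]≔ lit 1 ⨾
  for index count #sets (queue [ var wr ]≔ mask [ var index ] ⨾ wr ≔ suc-of (var wr)) ⨾
  mask [ var set ]≔ lit 0 ⨾
  next ≔ suc-of (var next)

pushChildren : Program
pushChildren = scan
  (blocked ≔ mask [ var set ] ⨾
   -- Equality is tested by two strict comparisons. Only for the star itself does `close` start at
   -- 1, which is the first disjunct of `Close`.
   if< (var set) (var star) (close ≔ lit 0) (if< (var star) (var set) (close ≔ lit 0) (close ≔ lit 1)))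
  (checkElem ⨾ if< (lit 0) (mark [ var elem ]) (close ≔ lit 1) (close ≔ var close))
  (if< (var blocked) (lit 1) (if< (lit 0) (var close) push (close ≔ var close)) (close ≔ var close))

fetch : Program
fetch = for index count #sets (mask [ var index ]≔ queue [ var rd ] ⨾ rd ≔ suc-of (var rd))

expand : Program
expand =
  fetch ⨾ reset ⨾ computeLoads ⨾ found ≔ lit 0 ⨾ findStar ⨾
  if< (lit 0) (var found) (markStar ⨾ pushChildren) (close ≔ lit 0)

-- One round replaces the queued partial solutions by their children.
level : Program
level =
  current ≔ var next ⨾ next ≔ lit 0 ⨾
  while< (lit 0) (var current) (expand ⨾ current ≔ pred-of (var current)) ⨾
  rounds ≔ pred-of (var rounds)

search : Program
search =
  -- The array `queue` is still all 0, so its first `m` cells already form the characteristic vector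
  -- of the empty subfamily; only the writing pointer has to be moved past them.
  wr ≔ #sets ⨾ next ≔ lit 1 ⨾ rounds ≔ #chosen ⨾
  while< (lit 0) (var rounds) level ⨾
  if< (lit 0) (var next) (answer ≔ lit 1) (answer ≔ lit 0)

-- The first set starts at position `3 + n`, which has to be counted up in the absence of addition.
findBase : Program
findBase = base ≔ lit 3 ⨾ for index count #elements (base ≔ suc-of (var base))

checkAll : Program
checkAll =
  for index count #sets (mask [ var index ]≔ lit 1) ⨾ reset ⨾ computeLoads ⨾ over ≔ lit 0 ⨾
  for index count #elements (if< (capacity index) (load# [ var index ]) (over ≔ lit 1) (close ≔ var close))

-- For `k = 0` the time bound is of order `n + m`, which may be less than one scan of the sets, so
-- this case is answered before anything is read from them. Excluding `m < k` next makes `k` sets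
-- available if the whole family is feasible, and keeps the fixed cost of `k` rounds linear in `m`.
solver : Program
solver =
  if< #chosen (lit 1) (answer ≔ lit 1)
    (if< #sets #chosen (answer ≔ lit 0)
      (findBase ⨾ checkAll ⨾ if< (var over) (lit 1) (answer ≔ lit 1) search))

-- Correctness and running time of the program

Segment : (ℕ → ℕ) → ℕ → List ℕ → Set
Segment f p []       = ⊤
Segment f p (x ∷ xs) = f p ≡ x × Segment f (suc p) xs

segment-nth : ∀ {f} ys p → (∀ q → f (p + q) ≡ nth ys q) → Segment f p ys
segment-nth []       p eq = tt
segment-nth {f} (y ∷ ys) p eq =
  trans (cong f (sym (+-identityʳ p))) (eq 0) ,
  segment-nth ys (suc p) λ q → trans (cong f (sym (+-suc p q))) (eq (suc q))

update-at : ∀ (f : ℕ → ℕ) {x y} v → x ≡ y → update f x v y ≡ v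
update-at f {x} v refl = setVar-at x v (state f (λ _ _ → 0))

≢⇒≡ᵇ-false : ∀ {x y} → x ≢ y → (x ≡ᵇ y) ≡ false
≢⇒≡ᵇ-false {x} {y} x≢y with x ≡ᵇ y in eq
... | false = refl
... | true  = contradiction (≡ᵇ⇒≡ x y (subst T (sym eq) tt)) x≢y

update-off : ∀ (f : ℕ → ℕ) {x y} v → x ≢ y → update f x v y ≡ f y
update-off f {x} {y} v x≢y = update-other f x v y (≢⇒≡ᵇ-false x≢y)

segment-push : ∀ {f} xs p e v → e ≡ p + length xs → Segment f p xs → Segment (update f e v) p (xs ++ v ∷ [])
segment-push {f} [] p e v e≡ _ = update-at f v (trans e≡ (+-identityʳ p)) , tt
segment-push {f} (x ∷ xs) p e v e≡ (fp , seg) =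
  trans (update-off f v (λ e≡p → m+1+n≢m p (trans (sym e≡) e≡p))) fp ,
  segment-push xs (suc p) e v (trans e≡ (+-suc p (length xs))) seg

∑-scale : ∀ {A : Set} (f : A → ℕ) c xs → ∑ xs (λ x → f x * c) ≡ ∑ xs f * c
∑-scale f c []       = refl
∑-scale f c (x ∷ xs) = trans (cong (f x * c +_) (∑-scale f c xs)) (sym (*-distribʳ-+ c (f x) _))

module Verification (I : Instance) where
  open Instance I
  open Family I

  tape : ℕ → ℕ
  tape = nth (encodeInstance I)

  encodedSets : List (Fin m) → List ℕ
  encodedSets = concatMap (λ j → ∣ F j ∣ ∷ elements (F j))

  nth-tabulate-< : ∀ {l} (f : Fin l → ℕ) ys i → nth (List.tabulate f ++ ys) (toℕ i) ≡ f i
  nth-tabulate-< f ys zero    = refl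
  nth-tabulate-< f ys (suc i) = nth-tabulate-< (f ∘ suc) ys i

  nth-tabulate-≥ : ∀ {l} (f : Fin l → ℕ) ys q → nth (List.tabulate f ++ ys) (l + q) ≡ nth ys q
  nth-tabulate-≥ {zero}  f ys q = refl
  nth-tabulate-≥ {suc l} f ys q = nth-tabulate-≥ (f ∘ suc) ys q

  tape-cap : ∀ i → tape (3 + toℕ i) ≡ cap i
  tape-cap = nth-tabulate-< cap _

  tape-sets : Segment tape (3 + n) (encodedSets (allFin m))
  tape-sets = segment-nth _ (3 + n) (nth-tabulate-≥ cap _)

  -- W is the unit in which the time spent on one partial solution is measured:
  -- each of n, m, the number of children times m, and ∑ⱼ ∣ F j ∣ is at most W.
  B W : ℕ
  B = 1 ⊔ (n + m)
  W = B * b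

  1≤B : 1 ≤ B
  1≤B = m≤m⊔n 1 (n + m)

  n≤B : n ≤ B
  n≤B = ≤-trans (m≤m+n n m) (m≤n⊔m 1 (n + m))

  m≤B : m ≤ B
  m≤B = ≤-trans (m≤n+m m n) (m≤n⊔m 1 (n + m))

  B≤W : B ≤ W
  B≤W = ≤-trans (≤-reflexive (sym (*-identityʳ B))) (*-monoʳ-≤ B 1≤b)

  1≤W : 1 ≤ W
  1≤W = ≤-trans 1≤B B≤W

  c≤c*W : ∀ c → c ≤ c * W
  c≤c*W c = ≤-trans (≤-reflexive (sym (*-identityʳ c))) (*-monoʳ-≤ c 1≤W)

  units : ∀ {P σ c Q} → Run P σ c Q → Run P σ (c * W) Q
  units = weaken (c≤c*W _)

  -- Costs are rounded up to whole multiples of `W`, so that composing phases only adds numerals.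
  phase : ∀ {P R σ} {Q Q′ : State → Set} c d → Run P σ (c * W) Q′ →
    (∀ {τ} → Q′ τ → Run R τ (d * W) Q) → Run (P ⨾ R) σ ((c + d) * W) Q
  phase c d p q = weaken (≤-reflexive (sym (*-distribʳ-+ W c d))) (p then q)

  -- Setup contributes `6 + e` and each of the `l` iterations `9 + c`. The unit `V` is a parameter
  -- because `push` is measured in `B` and the other loops in `W`.
  for-cost : ∀ {l V} e c → 1 ≤ V → l ≤ V → 6 + (e + ∑ (allFin l) (λ _ → 3 + (c + 6))) ≤ (15 + e + c) * V
  for-cost {l} {V} e c 1≤V l≤V = begin
    6 + (e + ∑ (allFin l) (λ _ → 3 + (c + 6))) ≡⟨ sym (+-assoc 6 e _) ⟩
    (6 + e) + ∑ (allFin l) (λ _ → 3 + (c + 6)) ≡⟨ cong (6 + e +_) (trans (∑-const (allFin l) (3 + (c + 6))) (cong₂ _*_ (length-tabulate {n = l} id) (cong (3 +_) (+-comm c 6)))) ⟩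
    (6 + e) + l * (9 + c)                      ≤⟨ +-mono-≤ (≤-trans (≤-reflexive (sym (*-identityʳ (6 + e)))) (*-monoʳ-≤ (6 + e) 1≤V)) (≤-trans (*-monoˡ-≤ (9 + c) l≤V) (≤-reflexive (*-comm V (9 + c)))) ⟩
    (6 + e) * V + (9 + c) * V                  ≡⟨ sym (*-distribʳ-+ V (6 + e) (9 + c)) ⟩
    ((6 + e) + (9 + c)) * V                    ≡⟨ cong (_* V) (+-interchange 6 e 9 c) ⟩
    (15 + (e + c)) * V                         ≡⟨ cong (_* V) (sym (+-assoc 15 e c)) ⟩
    (15 + e + c) * V ∎
    where open ≤-Reasoning

  -- Scanning the sets on the tape

  Input : State → Set
  Input σ = arrays σ input ≡ tape

  AtSets : State → List (Fin m) → Set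
  AtSets σ js = Segment tape (vars σ ptr) (encodedSets js)

  -- Two assignments and the final guard cost 9; the guard and three assignments make 12 per
  -- element, besides the body. The tape after the set is carried along as `js`, so that `ptr` is
  -- known to end at the next set.
  readSet-run : ∀ {body c j js σ} (Inv : List (Fin n) → State → Set) →
    writesVar body ptr ≡ false → writesVar body todo ≡ false → writesArray body input ≡ false →
    (∀ {is σ v} → Inv is σ → Inv is (setVar todo v σ)) →
    (∀ {is σ v} → Inv is σ → Inv is (setVar ptr v σ)) →
    (∀ {is σ v} → Inv is σ → Inv is (setVar elem v σ)) →
    (∀ {i is τ} → Input τ → vars τ elem ≡ toℕ i → Inv (i ∷ is) τ → Run body τ c (Inv is)) →
    Input σ → AtSets σ (j ∷ js) → Inv (members j) σ →
    Run (readSet body) σ (9 + ∣ F j ∣ * (12 + c)) (λ τ → Input τ × AtSets τ js × Inv [] τ)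
  readSet-run {body} {c} {j} {js} {σ} Inv wp wt wi st sp se step inp (size , seg) inv =
    weaken (≤-reflexive (cong (9 +_) (trans (∑-const (members j) (12 + c)) (cong (_* (12 + c)) (length-members j)))))
    (≔-then (≔-then (while-run Inv′ (λ _ → 9 + c) (λ {is} {τ} (len , _) → len) step′ (members j)
      ( trans (cong (λ f → f (vars σ ptr)) inp) (trans size (sym (length-members j)))
      , inp , seg , sp (st inv))
      ▷ λ (_ , inp′ , seg′ , inv′) → inp′ , seg′ , inv′)))
    where
    Inv′ : List (Fin n) → State → Set
    Inv′ is τ = vars τ todo ≡ length is × Input τ × Segment tape (vars τ ptr) (map toℕ is ++ encodedSets js) × Inv is τ
    step′ : ∀ {i is τ} → Inv′ (i ∷ is) τ →
      Run (elem ≔ input [ var ptr ] ⨾ ptr ≔ suc-of (var ptr) ⨾ todo ≔ pred-of (var todo) ⨾ body) τ (9 + c) (Inv′ is)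
    step′ {i} {is} {τ} (len , inp , (here≡ , seg) , inv) =
      ≔-then (≔-then (≔-then (framed (step inp (trans (cong (λ f → f (vars τ ptr)) inp) here≡) (st (sp (se inv))))
        ▷ λ { (sm , h) → trans (sameVar sm todo wt) (cong pred len)
            , trans (sameArray sm input wi) inp
            , subst (λ p → Segment tape p (map toℕ is ++ encodedSets js)) (sym (sameVar sm ptr wp)) seg
            , h })))

  -- The extra cost `g j` is summed separately instead of being bounded by a common maximum: a push
  -- takes time of order `m`, and only the branches, at most `b` of the sets, incur it. The numeral
  -- 40 is 10 for setup, 18 per set and 12 per element, each rounded up by `m ≤ W` or `m * b ≤ W`.
  scan-cost : ∀ cp cf c (g : Fin m → ℕ) →
    2 + (8 + ∑ (allFin m) (λ j → 3 + ((cp + ((9 + ∣ F j ∣ * (12 + c)) + (cf + g j))) + 6)))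
      ≤ (40 + (cp + cf + c)) * W + ∑ (allFin m) g
  scan-cost cp cf c g = begin
    10 + ∑ (allFin m) (λ j → 3 + ((cp + ((9 + ∣ F j ∣ * (12 + c)) + (cf + g j))) + 6))
      ≤⟨ +-monoʳ-≤ 10 (∑-mono each (allFin m)) ⟩
    10 + ∑ (allFin m) (λ j → K + b * (12 + c) + g j)
      ≡⟨ cong (10 +_) (∑-+ (λ _ → K + b * (12 + c)) g (allFin m)) ⟩
    10 + (∑ (allFin m) (λ _ → K + b * (12 + c)) + ∑ (allFin m) g)
      ≡⟨ cong (λ x → 10 + (x + ∑ (allFin m) g)) (trans (∑-const (allFin m) _) (cong (_* (K + b * (12 + c))) (length-tabulate {n = m} id))) ⟩
    10 + (m * (K + b * (12 + c)) + ∑ (allFin m) g)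
      ≡⟨ sym (+-assoc 10 (m * (K + b * (12 + c))) _) ⟩
    10 + m * (K + b * (12 + c)) + ∑ (allFin m) g
      ≤⟨ +-monoˡ-≤ _ (+-mono-≤ (c≤c*W 10) (≤-trans (≤-reflexive (*-distribˡ-+ m K (b * (12 + c)))) (+-mono-≤ mK mb))) ⟩
    10 * W + (K * W + (12 + c) * W) + ∑ (allFin m) g
      ≡⟨ cong (_+ ∑ (allFin m) g) (trans (cong (10 * W +_) (sym (*-distribʳ-+ W K (12 + c)))) (sym (*-distribʳ-+ W 10 (K + (12 + c))))) ⟩
    (10 + (K + (12 + c))) * W + ∑ (allFin m) g
      ≡⟨ cong (λ x → (28 + x) * W + ∑ (allFin m) g) (trans (sym (+-assoc (cp + cf) 12 c)) (trans (cong (_+ c) (+-comm (cp + cf) 12)) (+-assoc 12 (cp + cf) c))) ⟩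
    (40 + (cp + cf + c)) * W + ∑ (allFin m) g ∎
    where
    open ≤-Reasoning
    K = 18 + (cp + cf)
    each : ∀ j → 3 + ((cp + ((9 + ∣ F j ∣ * (12 + c)) + (cf + g j))) + 6) ≤ K + b * (12 + c) + g j
    each j = begin
      3 + ((cp + ((9 + x) + (cf + g j))) + 6) ≡⟨ cong (3 +_) (+-comm _ 6) ⟩
      9 + (cp + ((9 + x) + (cf + g j)))       ≡⟨ cong (λ y → 9 + (cp + y)) (+-assoc 9 x (cf + g j)) ⟩
      9 + (cp + (9 + (x + (cf + g j))))       ≡⟨ cong (9 +_) (trans (sym (+-assoc cp 9 _)) (trans (cong (_+ (x + (cf + g j))) (+-comm cp 9)) (+-assoc 9 cp _))) ⟩
      18 + (cp + (x + (cf + g j)))            ≡⟨ cong (λ y → 18 + (cp + y)) (trans (sym (+-assoc x cf (g j))) (trans (cong (_+ g j) (+-comm x cf)) (+-assoc cf x (g j)))) ⟩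
      18 + (cp + (cf + (x + g j)))            ≡⟨ cong (18 +_) (sym (+-assoc cp cf _)) ⟩
      K + (x + g j)                           ≡⟨ sym (+-assoc K x (g j)) ⟩
      K + x + g j                             ≤⟨ +-monoˡ-≤ (g j) (+-monoʳ-≤ K (*-monoˡ-≤ (12 + c) (∣F∣≤b j))) ⟩
      K + b * (12 + c) + g j ∎
      where x = ∣ F j ∣ * (12 + c)
    mK : m * K ≤ K * W
    mK = ≤-trans (*-monoˡ-≤ K (≤-trans m≤B B≤W)) (≤-reflexive (*-comm W K))
    mb : m * (b * (12 + c)) ≤ (12 + c) * W
    mb = ≤-trans (≤-reflexive (sym (*-assoc m b (12 + c))))
      (≤-trans (*-monoˡ-≤ (12 + c) (*-monoˡ-≤ b m≤B)) (≤-reflexive (*-comm W (12 + c))))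

  -- `Inv` holds between sets and `Mid j` while set `j` is being read; their lists are the sets and
  -- the elements of `F j` still to come. Stability is asked for exactly the variables that the scan
  -- itself overwrites.
  scan-run : ∀ {pre body post cp c cf σ} (g : Fin m → ℕ)
    (Inv : List (Fin m) → State → Set)
    (Mid : Fin m → List (Fin m) → List (Fin n) → State → Set) →
    writesVar body ptr ≡ false → writesVar body todo ≡ false → writesArray body input ≡ false →
    writesVar pre ptr ≡ false → writesArray pre input ≡ false →
    writesVar post ptr ≡ false → writesArray post input ≡ false →
    (∀ x → (x ≡ set ⊎ x ≡ left) → writesVar (pre ⨾ readSet body ⨾ post) x ≡ false) →
    (∀ {js σ v} → Inv js σ → Inv js (setVar ptr v σ)) →
    (∀ {js σ v} → Inv js σ → Inv js (setVar set v σ)) →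
    (∀ {js σ v} → Inv js σ → Inv js (setVar left v σ)) →
    (∀ {j js is σ v} → Mid j js is σ → Mid j js is (setVar todo v σ)) →
    (∀ {j js is σ v} → Mid j js is σ → Mid j js is (setVar ptr v σ)) →
    (∀ {j js is σ v} → Mid j js is σ → Mid j js is (setVar elem v σ)) →
    (∀ {j js τ} → AtSets τ (j ∷ js) → vars τ set ≡ toℕ j → Inv (j ∷ js) τ →
      Run pre τ cp (Mid j js (members j))) →
    (∀ {j js i is τ} → Input τ → vars τ elem ≡ toℕ i → Mid j js (i ∷ is) τ → Run body τ c (Mid j js is)) →
    (∀ {j js τ} → Input τ → Mid j js [] τ → Run post τ (cf + g j) (Inv js)) →
    Input σ → vars σ base ≡ 3 + n → Inv (allFin m) σ →
    Run (scan pre body post) σ ((40 + (cp + cf + c)) * W + ∑ (allFin m) g) (Inv [])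
  scan-run {pre} {body} {post} {cp} {c} {cf} {σ} g Inv Mid bp bt bi pp pi qp qi sl stp sts stl mt mp me hpre hbody hpost inp hbase inv =
    weaken (scan-cost cp cf c g)
    (≔-then (for-run Inv′ (λ j → cp + ((9 + ∣ F j ∣ * (12 + c)) + (cf + g j)))
       (sl set (inj₁ refl)) (sl left (inj₂ refl)) refl refl
       (λ (i , s , v) → i , s , stl (sts v))
       (cong (λ f → f 1) inp)
       step
       (inp , subst (λ p → Segment tape p (encodedSets (allFin m))) (sym hbase) tape-sets , stp inv)
     ▷ λ (_ , _ , v) → v))
    where
    Inv′ : List (Fin m) → State → Set
    Inv′ js τ = Input τ × AtSets τ js × Inv js τ
    step : ∀ {j js τ} → Inv′ (j ∷ js) τ → vars τ set ≡ toℕ j →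
      Run (pre ⨾ readSet body ⨾ post) τ (cp + ((9 + ∣ F j ∣ * (12 + c)) + (cf + g j))) (Inv′ js)
    step {j} {js} {τ} (inp , seg , v) set≡ =
      framed (hpre seg set≡ v) then λ {υ} (sm , mid) →
      readSet-run {j = j} {js = js} (Mid j js) bp bt bi mt mp me hbody (trans (sameArray sm input pi) inp)
        (subst (λ p → Segment tape p (encodedSets (j ∷ js))) (sym (sameVar sm ptr pp)) seg) mid
      then λ {φ} (inp′ , seg′ , mid′) →
      framed (hpost inp′ mid′) ▷ λ (sm′ , v′) →
        trans (sameArray sm′ input qi) inp′ ,
        subst (λ p → Segment tape p (encodedSets js)) (sym (sameVar sm′ ptr qp)) seg′ , v′

  HasMask : Subset m → State → Set
  HasMask T σ = ∀ j → arrays σ mask (toℕ j) ≡ bit (lookup T j)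

  HasLoads : Subset m → State → Set
  HasLoads T σ = ∀ i → arrays σ load# (toℕ i) ≡ load T i

  HasMark : Fin m → State → Set
  HasMark s σ = ∀ i → (0 < arrays σ mark (toℕ i) → i ∈ F s) × (i ∈ F s → 0 < arrays σ mark (toℕ i))

  Cleared : State → Set
  Cleared σ = ∀ i → arrays σ load# (toℕ {n} i) ≡ 0 × arrays σ mark (toℕ i) ≡ 0

  bit-pos : ∀ {x} → 0 < bit x → x ≡ true
  bit-pos {true} _ = refl

  for-units : ∀ {l P σ Q} e c → l ≤ B → Run P σ (6 + (e + ∑ (allFin l) (λ _ → 3 + (c + 6)))) Q →
    Run P σ ((15 + e + c) * W) Q
  for-units e c l≤B = weaken (for-cost e c 1≤W (≤-trans l≤B B≤W))

  reset-run : ∀ {σ} → Input σ → Run reset σ (23 * W) Cleared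
  reset-run {σ} inp = for-units 2 6 n≤B
    (for-run Inv (λ _ → 6) refl refl refl refl (λ v → v) (cong (λ f → f 0) inp)
      (λ {_} {_} {τ} v idx → []≔-then (run-[]≔ (step {τ = τ} v idx))) (λ i → inj₁ (∈-allFin i))
     ▷ λ v i → Sum.[ (λ ()) , id ] (v i))
    where
    Inv : List (Fin n) → State → Set
    -- Each index is either still to come or already in its final condition; at the empty list only
    -- the second case survives.
    Inv is τ = ∀ i → i Mem.∈ is ⊎ (arrays τ load# (toℕ i) ≡ 0 × arrays τ mark (toℕ i) ≡ 0)
    step : ∀ {i is τ} → Inv (i ∷ is) τ → vars τ index ≡ toℕ i →
      Inv is (setCell mark (vars τ index) 0 (setCell load# (vars τ index) 0 τ))
    step {i} {is} {τ} v idx i′ with vars τ index ≟ toℕ i′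
    ... | yes eq = inj₂ (update-at (arrays τ load#) 0 eq , update-at (arrays τ mark) 0 eq)
    ... | no neq with v i′
    ...   | inj₁ (here refl) = contradiction idx neq
    ...   | inj₁ (there i′∈) = inj₁ i′∈
    ...   | inj₂ (l≡0 , m≡0) = inj₂
            ( trans (update-off (arrays τ load#) 0 neq) l≡0
            , trans (update-off (arrays τ mark) 0 neq) m≡0)

  no-extra : ∀ c → c * W + ∑ (allFin m) (λ _ → 0) ≤ c * W
  no-extra c = ≤-reflexive (trans (cong (c * W +_) (trans (∑-const (allFin m) 0) (*-zeroʳ (length (allFin m))))) (+-identityʳ _))

  computeLoads-run : ∀ {T σ} → Input σ → vars σ base ≡ 3 + n → HasMask T σ → Cleared σ →
    Run computeLoads σ (53 * W) (HasLoads T)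
  computeLoads-run {T} {σ} inp hb msk clr =
    weaken (no-extra 53)
    (scan-run {cp = 2} {c = 9} {cf = 2} (λ _ → 0) Inv Mid refl refl refl refl refl refl refl
      (λ { _ (inj₁ refl) → refl ; _ (inj₂ refl) → refl })
      (λ v → v) (λ v → v) (λ v → v) (λ v → v) (λ v → v) (λ v → v)
      (λ {j} {js} {τ} _ set≡ (msk , v) → run-≔ (msk , set≡ , λ i →
        trans (cong (λ h → arrays τ load# (toℕ i) + (bit (lookup T j) * h + rest js i)) (hits-members i j)) (v i)))
      (λ {j} {js} {i} {is} {τ} _ e≡ (msk , set≡ , v) →
        run-if (λ pos → run-[]≔ (msk , set≡ , add {js = js} {is = is} {τ} e≡ (bit-pos (subst (0 <_) (trans (cong (arrays τ mask) set≡) (msk j)) pos)) v))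
               (λ neg → run-≔ (msk , set≡ , stay {js = js} {i} {is} {τ} (trans (sym (trans (cong (arrays τ mask) set≡) (msk j))) (n≤0⇒n≡0 neg)) v)))
      (λ {j} {js} {τ} _ (msk , set≡ , v) → run-≔ (msk , λ i →
        trans (cong (λ h → arrays τ load# (toℕ i) + (h + rest js i)) (sym (*-zeroʳ (bit (lookup T j))))) (v i)))
      inp hb (msk , λ i → trans (cong (_+ _) (proj₁ (clr i))) (load-∑ T i))
     ▷ λ (_ , v) i → trans (sym (+-identityʳ _)) (v i))
    where
    rest : List (Fin m) → Fin n → ℕ
    rest js i = ∑ js (λ j → bit (lookup T j) * bit (lookup (F j) i))
    Inv : List (Fin m) → State → Set
    -- The counter plus the contribution of the unread sets is constant, equal to the load. The scan
    -- moves terms from the second summand to the first, and `Mid` splits off the unread elements of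
    -- the current set in the same way.
    Inv js τ = HasMask T τ × (∀ i → arrays τ load# (toℕ i) + rest js i ≡ load T i)
    Mid : Fin m → List (Fin m) → List (Fin n) → State → Set
    Mid j js is τ = HasMask T τ × vars τ set ≡ toℕ j ×
      (∀ i → arrays τ load# (toℕ i) + (bit (lookup T j) * hits i is + rest js i) ≡ load T i)
    stay : ∀ {j js i is τ} → bit (lookup T j) ≡ 0 →
      (∀ i′ → arrays τ load# (toℕ i′) + (bit (lookup T j) * hits i′ (i ∷ is) + rest js i′) ≡ load T i′) →
      ∀ i′ → arrays τ load# (toℕ i′) + (bit (lookup T j) * hits i′ is + rest js i′) ≡ load T i′
    stay z v i′ rewrite z = v i′
    add : ∀ {j js i is τ} → vars τ elem ≡ toℕ i → lookup T j ≡ true →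
      (∀ i′ → arrays τ load# (toℕ i′) + (bit (lookup T j) * hits i′ (i ∷ is) + rest js i′) ≡ load T i′) →
      ∀ i′ → update (arrays τ load#) (vars τ elem) (suc (arrays τ load# (vars τ elem))) (toℕ i′)
        + (bit (lookup T j) * hits i′ is + rest js i′) ≡ load T i′
    add {j} {js} {i} {is} {τ} e≡ Tj v i′ rewrite Tj | e≡ with i′ Finₚ.≟ i | v i′
    ... | yes refl | eq rewrite update-at (arrays τ load#) (suc (arrays τ load# (toℕ i))) (refl {x = toℕ i}) =
          trans (sym (+-suc (arrays τ load# (toℕ i)) _)) eq
    ... | no i′≢i | eq = trans (cong (_+ _) (update-off (arrays τ load#) _ (λ p → i′≢i (sym (Finₚ.toℕ-injective p))))) eq

  -- The list holds the elements not yet read, so once it is empty the variable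
  -- decides Blocked T j.  CloseSoFar works in the same way.
  BlockedSoFar : Subset m → Fin m → List (Fin n) → State → Set
  BlockedSoFar T j is τ =
    (0 < vars τ blocked ⊎ Any (λ i → cap i ≤ load T i) is → Blocked T j) ×
    (Blocked T j → 0 < vars τ blocked ⊎ Any (λ i → cap i ≤ load T i) is)

  blocked-init : ∀ {T j τ} → vars τ set ≡ toℕ j → HasMask T τ →
    BlockedSoFar T j (members j) (setVar blocked (arrays τ mask (vars τ set)) τ)
  blocked-init {T} {j} {τ} set≡ msk =
    Sum.map₁ (λ pos → lookup⇒[]= j T (bit-pos (subst (0 <_) mask≡ pos))) ,
    Sum.map₁ (λ j∈ → subst (0 <_) (sym (trans mask≡ (cong bit ([]=⇒lookup j∈)))) (s≤s z≤n))
    where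
    mask≡ : arrays τ mask (vars τ set) ≡ bit (lookup T j)
    mask≡ = trans (cong (arrays τ mask) set≡) (msk j)

  blocked-skip : ∀ {T j i is τ} → load T i < cap i → BlockedSoFar T j (i ∷ is) τ → BlockedSoFar T j is τ
  blocked-skip room (to , from) = (λ { (inj₁ p) → to (inj₁ p) ; (inj₂ a) → to (inj₂ (there a)) }) , back ∘ from
    where
    back : ∀ {X : Set} {is} → X ⊎ Any _ (_ ∷ is) → X ⊎ Any _ is
    back (inj₁ p)           = inj₁ p
    back (inj₂ (here full)) = contradiction full (<⇒≱ room)
    back (inj₂ (there a))   = inj₂ a

  blocked-set : ∀ {T j i is τ} → cap i ≤ load T i → BlockedSoFar T j (i ∷ is) τ →
    BlockedSoFar T j is (setVar blocked 1 τ)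
  blocked-set full (to , from) = (λ _ → to (inj₂ (here full))) , λ _ → inj₁ (s≤s z≤n)

  checkElem-run : ∀ {T i τ Q} → Input τ → HasLoads T τ → vars τ elem ≡ toℕ i →
    (load T i < cap i → Q (setVar close (vars τ close) τ)) →
    (cap i ≤ load T i → Q (setVar blocked 1 τ)) →
    Run checkElem τ 10 Q
  checkElem-run {T} {i} {τ} inp lds e≡ p q = run-if
    (λ lt → run-≔ (p (subst₂ _<_ load≡ cap≡ lt)))
    (λ le → run-≔ (q (subst₂ _≤_ cap≡ load≡ le)))
    where
    load≡ : arrays τ load# (vars τ elem) ≡ load T i
    load≡ = trans (cong (arrays τ load#) e≡) (lds i)
    cap≡ : arrays τ input (3 + vars τ elem) ≡ cap i
    cap≡ = trans (cong₂ (λ f x → f (3 + x)) inp e≡) (tape-cap i)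

  StarAt : Subset m → Fin m → State → Set
  StarAt T s τ = ¬ Blocked T s × vars τ star ≡ toℕ s ×
    ∃[ js ] Segment tape (vars τ starPtr) (encodedSets (s ∷ js))

  -- At the empty list the two cases correspond to the two constructors of `Expansion`.
  Search : Subset m → List (Fin m) → State → Set
  Search T js τ =
    (vars τ found ≡ 0 × (∀ j → j Mem.∈ js ⊎ Blocked T j)) ⊎
    (vars τ found ≡ 1 × ∃[ s ] StarAt T s τ)

  findStar-run : ∀ {T σ} → Input σ → vars σ base ≡ 3 + n → HasMask T σ → HasLoads T σ → vars σ found ≡ 0 →
    Run findStar σ (64 * W) (Search T [])
  findStar-run {T} {σ} inp hb msk lds found≡0 =
    weaken (no-extra 64)
    (scan-run {cp = 5} {c = 10} {cf = 9} (λ _ → 0) Inv Mid refl refl refl refl refl refl refl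
      (λ { _ (inj₁ refl) → refl ; _ (inj₂ refl) → refl })
      (λ v → v) (λ v → v) (λ v → v) (λ v → v) (λ v → v) (λ v → v)
      (λ {j} {js} {τ} seg set≡ (msk , lds , v) →
        ≔-then (run-≔ (msk , lds , v , seg , set≡ , blocked-init {T} {j} {τ} set≡ msk)))
      (λ {j} {js} {i} {is} {τ} inp e≡ (msk , lds , v , seg , set≡ , bl) →
        checkElem-run {T} inp lds e≡
          (λ room → msk , lds , v , seg , set≡ , blocked-skip {T} {j} {i} {is} {τ} room bl)
          (λ full → msk , lds , v , seg , set≡ , blocked-set {T} {j} {i} {is} {τ} full bl))
      (λ {j} {js} {τ} _ (msk , lds , v , seg , set≡ , to , from′) →
        run-if
          (λ b<1 → ≔-then (≔-then (run-≔ (msk , lds , inj₂ (refl , j ,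
            (λ bl → not-blocked (subst (_< 1) refl b<1) (from′ bl)) , set≡ , js , seg)))))
          (λ 1≤b → run-≔ (msk , lds , advance {j} {js} {τ} (to (inj₁ 1≤b)) v)))
      inp hb (msk , lds , inj₁ (found≡0 , λ j → inj₁ (∈-allFin j)))
     ▷ λ (_ , _ , v) → v)
    where
    Inv : List (Fin m) → State → Set
    Inv js τ = HasMask T τ × HasLoads T τ × Search T js τ
    Mid : Fin m → List (Fin m) → List (Fin n) → State → Set
    Mid j js is τ = HasMask T τ × HasLoads T τ × Search T (j ∷ js) τ ×
      Segment tape (vars τ from) (encodedSets (j ∷ js)) × vars τ set ≡ toℕ j × BlockedSoFar T j is τ
    not-blocked : ∀ {x P} → x < 1 → ¬ (0 < x ⊎ Any {A = Fin n} P [])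
    not-blocked (s≤s z≤n) (inj₁ ())
    advance : ∀ {j js τ} → Blocked T j → Search T (j ∷ js) τ → Search T js τ
    advance bl (inj₂ v) = inj₂ v
    advance {j} {js} bl (inj₁ (f , all)) = inj₁ (f , λ j′ → adv (all j′))
      where
      adv : ∀ {j′} → j′ Mem.∈ (j ∷ js) ⊎ Blocked T j′ → j′ Mem.∈ js ⊎ Blocked T j′
      adv (inj₁ (here refl)) = inj₂ bl
      adv (inj₁ (there j∈))  = inj₁ j∈
      adv (inj₂ bl)          = inj₂ bl

  markStar-run : ∀ {T s σ} → Input σ → StarAt T s σ → (∀ i → arrays σ mark (toℕ {n} i) ≡ 0) → Run markStar σ (27 * W) (HasMark s)
  markStar-run {T} {s} {σ} inp (_ , _ , js , seg) clr =
    weaken cost≤ (≔-then (readSet-run {j = s} {js = js} Inv refl refl refl (λ v → v) (λ v → v) (λ v → v)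
      (λ {i} {is} {τ} _ e≡ v → run-[]≔ (step {i} {is} {τ} e≡ v)) inp seg init
      ▷ λ (_ , _ , v) i → (λ pos → proj₁ (v i) (inj₁ pos)) , λ i∈ → Sum.[ id , (λ ()) ] (proj₂ (v i) i∈)))
    where
    Inv : List (Fin n) → State → Set
    Inv is τ = ∀ i → (0 < arrays τ mark (toℕ i) ⊎ i Mem.∈ is → i ∈ F s) × (i ∈ F s → 0 < arrays τ mark (toℕ i) ⊎ i Mem.∈ is)
    init : Inv (members s) σ
    init i = (λ { (inj₁ pos) → contradiction (clr i) (λ z → <-irrefl (sym z) pos) ; (inj₂ i∈) → ∈-members⁻ {j = s} i∈ })
           , λ i∈ → inj₂ (∈-members⁺ i∈)
    step : ∀ {i is τ} → vars τ elem ≡ toℕ i → Inv (i ∷ is) τ → Inv is (setCell mark (vars τ elem) 1 τ)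
    step {i} {is} {τ} e≡ v i′ with i′ Finₚ.≟ i
    ... | yes refl = (λ _ → proj₁ (v i) (inj₂ (here refl))) ,
                     λ _ → inj₁ (subst (0 <_) (sym (update-at (arrays τ mark) 1 e≡)) (s≤s z≤n))
    ... | no i′≢i = (λ { (inj₁ pos) → proj₁ (v i′) (inj₁ (subst (0 <_) off pos)) ; (inj₂ i∈) → proj₁ (v i′) (inj₂ (there i∈)) })
                  , λ i∈ → back (proj₂ (v i′) i∈)
      where
      off : update (arrays τ mark) (vars τ elem) 1 (toℕ i′) ≡ arrays τ mark (toℕ i′)
      off = update-off (arrays τ mark) 1 (λ p → i′≢i (sym (Finₚ.toℕ-injective (trans (sym e≡) p))))
      back : 0 < arrays τ mark (toℕ i′) ⊎ i′ Mem.∈ (i ∷ is) → 0 < update (arrays τ mark) (vars τ elem) 1 (toℕ i′) ⊎ i′ Mem.∈ is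
      back (inj₁ pos)        = inj₁ (subst (0 <_) (sym off) pos)
      back (inj₂ (here eq))  = contradiction eq i′≢i
      back (inj₂ (there i∈)) = inj₂ i∈
    cost≤ : 2 + (9 + ∣ F s ∣ * (12 + 3)) ≤ 27 * W
    cost≤ = ≤-trans (+-mono-≤ (c≤c*W 11) (≤-trans (*-monoˡ-≤ 15 (≤-trans (∣F∣≤b s)
        (≤-trans (≤-reflexive (sym (*-identityˡ b))) (*-monoˡ-≤ b 1≤B)))) (≤-reflexive (*-comm W 15))))
      (≤-trans (≤-reflexive (sym (*-distribʳ-+ W 11 15))) (*-monoˡ-≤ W (n≤1+n 26)))

  -- The queue and the production of children

  bits : Subset m → List ℕ
  bits T = map (bit ∘ lookup T) (allFin m)

  Holds : State → List (Subset m) → Set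
  Holds τ ms = Segment (arrays τ queue) (vars τ rd) (concatMap bits ms) ×
    vars τ wr ≡ vars τ rd + length (concatMap bits ms)

  concatMap-bits-∷ʳ : ∀ ms T → concatMap bits (ms ++ T ∷ []) ≡ concatMap bits ms ++ bits T
  concatMap-bits-∷ʳ ms T = trans (concatMap-++ bits ms (T ∷ [])) (cong (concatMap bits ms ++_) (++-identityʳ (bits T)))

  -- The cost is measured in `B`, not in `W`: an expansion may push `b` times, and the total is then
  -- a multiple of `B * b`, which is `W`.
  push-run : ∀ {T j ms σ} → Input σ → HasMask T σ → vars σ set ≡ toℕ j → lookup T j ≡ false → Holds σ ms →
    Run push σ (33 * B) (λ τ → HasMask T τ × Holds τ (ms ++ insert T j ∷ []) × vars τ next ≡ suc (vars σ next))
  push-run {T} {j} {ms} {σ} inp msk set≡ Tj (seg , len) =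
    weaken (≤-trans (≤-reflexive arith) (≤-trans (+-mono-≤ 9≤9B (for-cost 2 7 1≤B m≤B)) (≤-reflexive (sym (*-distribʳ-+ B 9 24)))))
    ([]≔-then (framed (for-run Inv (λ _ → 7) refl refl refl refl (λ v → v) (cong (λ f → f 1) inp)
      (λ {j′} {js} {τ} v idx → []≔-then (run-≔ (copy {τ = τ} v idx))) (inserted , concatMap bits ms , seg , len , refl))
     then λ {τ} (sm , msk′ , xs , seg′ , len′ , eq) →
       let xs≡ : xs ≡ concatMap bits (ms ++ insert T j ∷ [])
           xs≡ = trans (sym (++-identityʳ xs)) (trans eq (sym (concatMap-bits-∷ʳ ms (insert T j))))
       in []≔-then (run-≔
         ( restored {τ = τ} (trans (sameVar sm set refl) set≡) msk′
         , (subst (Segment (arrays τ queue) (vars τ rd)) xs≡ seg′ , trans len′ (cong (λ ys → vars τ rd + length ys) xs≡))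
         , cong suc (sameVar sm next refl)))))
    where
    T′ = insert T j
    σ₁ = setCell mask (vars σ set) 1 σ
    X = ∑ (allFin m) (λ _ → 3 + (7 + 6))
    arith : 3 + ((6 + (2 + X)) + (3 + 3)) ≡ 9 + (6 + (2 + X))
    arith = cong (3 +_) (+-comm (6 + (2 + X)) 6)
    9≤9B : 9 ≤ 9 * B
    9≤9B = *-monoʳ-≤ 9 1≤B
    inserted : HasMask T′ σ₁
    inserted j′ with j′ Finₚ.≟ j
    ... | yes refl = trans (update-at (arrays σ mask) 1 set≡) (cong bit (sym (lookup∘update j T inside)))
    ... | no j′≢j  = trans (update-off (arrays σ mask) 1 (λ p → j′≢j (sym (Finₚ.toℕ-injective (trans (sym set≡) p)))))
                       (trans (msk j′) (cong bit (sym (lookup∘update′ j′≢j T inside))))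
    restored : ∀ {τ} → vars τ set ≡ toℕ j → HasMask T′ τ → HasMask T (setCell mask (vars τ set) 0 τ)
    restored {τ} set≡ msk j′ with j′ Finₚ.≟ j
    ... | yes refl = trans (update-at (arrays τ mask) 0 set≡) (cong bit (sym Tj))
    ... | no j′≢j  = trans (update-off (arrays τ mask) 0 (λ p → j′≢j (sym (Finₚ.toℕ-injective (trans (sym set≡) p)))))
                       (trans (msk j′) (cong bit (lookup∘update′ j′≢j T inside)))
    -- During the copy the queue ends in an incomplete vector, so its contents are an arbitrary list
    -- `xs` that the remaining bits complete to the intended one.
    Inv : List (Fin m) → State → Set
    Inv js τ = HasMask T′ τ × ∃[ xs ] Segment (arrays τ queue) (vars τ rd) xs ×
      vars τ wr ≡ vars τ rd + length xs × xs ++ map (bit ∘ lookup T′) js ≡ concatMap bits ms ++ bits T′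
    copy : ∀ {j′ js τ} → Inv (j′ ∷ js) τ → vars τ index ≡ toℕ j′ →
      Inv js (setVar wr (suc (vars τ wr)) (setCell queue (vars τ wr) (arrays τ mask (vars τ index)) τ))
    copy {j′} {js} {τ} (msk , xs , seg , len , eq) idx =
      msk , xs ++ v ∷ [] , segment-push xs (vars τ rd) (vars τ wr) v len seg ,
      trans (cong suc len) (trans (sym (+-suc (vars τ rd) (length xs)))
        (cong (vars τ rd +_) (trans (+-comm 1 (length xs)) (sym (length-++ xs))))) ,
      trans (++-assoc xs (v ∷ []) _) (trans (cong (λ w → xs ++ w ∷ map (bit ∘ lookup T′) js) (trans (cong (arrays τ mask) idx) (msk j′))) eq)
      where v = arrays τ mask (vars τ index)

  CloseSoFar : Fin m → Fin m → List (Fin n) → State → Set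
  CloseSoFar s j is τ =
    (0 < vars τ close ⊎ Any (_∈ F s) is → Close s j) × (Close s j → 0 < vars τ close ⊎ Any (_∈ F s) is)

  far-init : ∀ {s j τ} → s ≢ j → CloseSoFar s j (members j) (setVar close 0 τ)
  far-init s≢j = (λ { (inj₂ a) → inj₂ a }) , λ { (inj₁ s≡j) → contradiction s≡j s≢j ; (inj₂ a) → inj₂ a }

  pushChildren-run : ∀ {T s qs σ} → Input σ → vars σ base ≡ 3 + n → HasMask T σ → HasLoads T σ →
    HasMark s σ → StarAt T s σ → Holds σ qs →
    Run pushChildren σ (108 * W) (λ τ → Holds τ (qs ++ children T s) × vars τ next ≡ vars σ next + length (children T s))
  pushChildren-run {T} {s} {qs} {σ} inp hb msk lds mrk (_ , star≡ , _) holds =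
    weaken cost≤
    (scan-run {cp = 11} {c = 16} {cf = 8} extra Inv Mid refl refl refl refl refl refl refl
      (λ { _ (inj₁ refl) → refl ; _ (inj₂ refl) → refl })
      (λ v → v) (λ v → v) (λ v → v) (λ v → v) (λ v → v) (λ v → v)
      (λ {j} {js} {τ} _ set≡ (ctx@(msk , _ , _ , star≡) , prog) →
        ≔-then (run-if
          (λ lt → run-≔ (ctx , prog , set≡ , blocked-init {T} {j} {τ} set≡ msk ,
             far-init {s} {j} {τ} λ { refl → <-irrefl (trans set≡ (sym star≡)) lt }))
          (λ le → run-if
            (λ lt → run-≔ (ctx , prog , set≡ , blocked-init {T} {j} {τ} set≡ msk ,
              far-init {s} {j} {τ} λ { refl → <-irrefl (trans star≡ (sym set≡)) lt }))
            (λ ge → run-≔ (ctx , prog , set≡ , blocked-init {T} {j} {τ} set≡ msk ,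
              (λ _ → inj₁ (Finₚ.toℕ-injective (trans (sym star≡) (trans (≤-antisym le ge) set≡)))) ,
              λ _ → inj₁ (s≤s z≤n))))))
      (λ {j} {js} {i} {is} {τ} inp e≡ (ctx@(_ , lds , mrk , _) , prog , set≡ , bl , cl) →
        checkElem-run {T} {Q = Mid′ j js i is} inp lds e≡
          (λ room → (ctx , prog , set≡ , blocked-skip {T} {j} {i} {is} {τ} room bl , cl) , e≡)
          (λ full → (ctx , prog , set≡ , blocked-set {T} {j} {i} {is} {τ} full bl , cl) , e≡)
        then λ {υ} → touch {j} {js} {i} {is} {υ})
      (λ {j} {js} {τ} inp v → finish-set {j} {js} {τ} inp v)
      inp hb ((msk , lds , mrk , star≡) , [] ,
        subst (Holds σ) (sym (++-identityʳ qs)) holds , sym (+-identityʳ _) , refl)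
     ▷ λ { {υ} (_ , ks , h , next≡ , eq) →
             let ks≡ = trans (sym (++-identityʳ ks)) eq in
             subst (λ ks → Holds υ (qs ++ ks)) ks≡ h , trans next≡ (cong (λ ks → vars σ next + length ks) ks≡) })
    where
    extra : Fin m → ℕ
    -- A push is charged only to the branches, so the sum is their number times `33 * B`, at most
    -- `33 * W`.
    extra j = bit (does (Branch? T s j)) * (33 * B)
    Progress : List (Fin m) → State → Set
    Progress js τ = ∃[ ks ] Holds τ (qs ++ ks) × vars τ next ≡ vars σ next + length ks ×
      ks ++ map (insert T) (filter (Branch? T s) js) ≡ children T s
    Context : State → Set
    Context τ = HasMask T τ × HasLoads T τ × HasMark s τ × vars τ star ≡ toℕ s
    Inv : List (Fin m) → State → Set
    Inv js τ = Context τ × Progress js τ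
    Mid : Fin m → List (Fin m) → List (Fin n) → State → Set
    Mid j js is τ = Context τ × Progress (j ∷ js) τ × vars τ set ≡ toℕ j ×
      BlockedSoFar T j is τ × CloseSoFar s j is τ
    Mid′ : Fin m → List (Fin m) → Fin n → List (Fin n) → State → Set
    Mid′ j js i is τ = (Context τ × Progress (j ∷ js) τ × vars τ set ≡ toℕ j ×
      BlockedSoFar T j is τ × CloseSoFar s j (i ∷ is) τ) × vars τ elem ≡ toℕ i

    touch : ∀ {j js i is τ} → Mid′ j js i is τ →
      Run (if< (lit 0) (mark [ var elem ]) (close ≔ lit 1) (close ≔ var close)) τ 6 (Mid j js is)
    touch {j} {js} {i} {is} {τ} ((ctx@(_ , _ , mrk , _) , prog , set≡ , bl , to , from′) , e≡) = run-if
      (λ pos → run-≔ (ctx , prog , set≡ , bl ,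
        (λ _ → to (inj₂ (here (proj₁ (mrk i) (subst (λ x → 0 < arrays τ mark x) e≡ pos))))) , λ _ → inj₁ (s≤s z≤n)))
      (λ neg → run-≔ (ctx , prog , set≡ , bl ,
        (λ { (inj₁ p) → to (inj₁ p) ; (inj₂ a) → to (inj₂ (there a)) }) , λ c → back neg (from′ c)))
      where
      back : arrays τ mark (vars τ elem) ≤ 0 → 0 < vars τ close ⊎ Any (_∈ F s) (i ∷ is) → 0 < vars τ close ⊎ Any (_∈ F s) is
      back neg (inj₁ p)          = inj₁ p
      back neg (inj₂ (there a))  = inj₂ a
      back neg (inj₂ (here i∈s)) = contradiction (proj₂ (mrk i) i∈s)
        (≤⇒≯ (subst (λ x → arrays τ mark x ≤ 0) e≡ neg))

    skip-set : ∀ {j js τ} → ¬ Branch T s j → Inv (j ∷ js) τ → Inv js τ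
    skip-set {j} ¬br (ctx , ks , h , next≡ , eq) =
      ctx , ks , h , next≡ , trans (cong (λ xs → ks ++ map (insert T) xs) (sym (filter-reject (Branch? T s) ¬br))) eq

    push-set : ∀ {j js τ} → Input τ → vars τ set ≡ toℕ j → Branch T s j → Inv (j ∷ js) τ →
      Run push τ (33 * B) (Inv js)
    push-set {j} {js} {τ} inp set≡ br ((msk , lds , mrk , star≡) , ks , h , next≡ , eq) =
      framed (push-run {T} {j} {qs ++ ks} inp msk set≡ (∉⇒lookup (proj₁ (unblocked (proj₁ br)))) h)
      ▷ λ { {υ} (sm , msk′ , h′ , next≡′) →
        ( msk′
        , (λ i → trans (cong (λ f → f (toℕ i)) (sameArray sm load# refl)) (lds i))
        , subst (λ f → ∀ i → (0 < f (toℕ i) → i ∈ F s) × (i ∈ F s → 0 < f (toℕ i))) (sym (sameArray sm mark refl)) mrk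
        , trans (sameVar sm star refl) star≡)
        , ks ++ insert T j ∷ []
        , subst (Holds υ) (++-assoc qs ks _) h′
        , trans next≡′ (trans (cong suc next≡) (trans (sym (+-suc _ (length ks)))
            (cong (vars σ next +_) (trans (+-comm 1 (length ks)) (sym (length-++ ks))))))
        , trans (++-assoc ks (insert T j ∷ []) _)
            (trans (cong (λ xs → ks ++ map (insert T) xs) (sym (filter-accept (Branch? T s) br))) eq) }

    finish-set : ∀ {j js τ} → Input τ → Mid j js [] τ →
      Run (if< (var blocked) (lit 1) (if< (lit 0) (var close) push (close ≔ var close)) (close ≔ var close)) τ
        (8 + extra j) (Inv js)
    finish-set {j} {js} {τ} inp (ctx , prog , set≡ , (bto , bfrom) , (cto , cfrom)) = decide (Branch? T s j) refl
      where
      v : Inv (j ∷ js) τ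
      v = ctx , prog
      -- The decision is an argument with an equation because the cost bound mentions
      -- `does (Branch? T s j)`.
      decide : (d : Dec (Branch T s j)) → d ≡ Branch? T s j →
        Run (if< (var blocked) (lit 1) (if< (lit 0) (var close) push (close ≔ var close)) (close ≔ var close)) τ
          (8 + extra j) (Inv js)
      decide (yes br) eq = weaken
        (≤-trans (+-monoʳ-≤ 3 (⊔-lub (+-monoʳ-≤ 3 (⊔-lub (m≤n+m (33 * B) 2) (m≤m+n 2 _))) (m≤m+n 2 _)))
          (+-monoʳ-≤ 8 (≤-reflexive (trans (sym (*-identityˡ _)) (cong (λ d → bit (does d) * (33 * B)) eq)))))
        (run-if {d = 2}
          (λ _ → run-if {d = 2} (λ _ → push-set {j} {js} {τ} inp set≡ br v)
            (λ c≤0 → ⊥-elim (Sum.[ ≤⇒≯ c≤0 , (λ ()) ] (cfrom (proj₂ br)))))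
          (λ 1≤b → ⊥-elim (proj₁ br (bto (inj₁ 1≤b)))))
      decide (no ¬br) eq = weaken (m≤m+n 8 (extra j))
        (run-if {c = 5} {d = 2}
          -- The push is unreachable for a set that is no branch, so its cost may be taken to be 0,
          -- and the nested tests fit into 8.
          (λ b<1 → run-if {c = 0} {d = 2}
            (λ 0<c → ⊥-elim (¬br ((λ bl → Sum.[ <⇒≱ b<1 , (λ ()) ] (bfrom bl)) , cto (inj₁ 0<c))))
            (λ _ → run-≔ (skip-set {j} {js} {τ} ¬br v)))
          (λ _ → run-≔ (skip-set {j} {js} {τ} ¬br v)))

    cost≤ : (40 + (11 + 8 + 16)) * W + ∑ (allFin m) extra ≤ 108 * W
    cost≤ = begin
      75 * W + ∑ (allFin m) extra                                             ≡⟨ cong (75 * W +_) (∑-scale _ (33 * B) (allFin m)) ⟩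
      75 * W + ∑ (allFin m) (λ j → bit (does (Branch? T s j))) * (33 * B)     ≡⟨ cong (λ x → 75 * W + x * (33 * B)) (sym (length-filter-∑ (Branch? T s) (allFin m))) ⟩
      75 * W + length (filter (Branch? T s) (allFin m)) * (33 * B)            ≤⟨ +-monoʳ-≤ (75 * W) (*-monoˡ-≤ (33 * B) (length-branches T s)) ⟩
      75 * W + b * (33 * B)                                                   ≡⟨ cong (75 * W +_) (trans (*-comm b (33 * B)) (*-assoc 33 B b)) ⟩
      75 * W + 33 * W                                                         ≡⟨ sym (*-distribʳ-+ W 75 33) ⟩
      108 * W ∎
      where open ≤-Reasoning

  fetch-run : ∀ {T ms σ} → Input σ → Holds σ (T ∷ ms) → Run fetch σ (24 * W) (λ τ → HasMask T τ × Holds τ ms)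
  fetch-run {T} {ms} {σ} inp (seg , len) = for-units 2 7 m≤B
    (for-run Inv (λ _ → 7) refl refl refl refl (λ v → v) (cong (λ f → f 1) inp)
      (λ {j} {js} {τ} v idx → []≔-then (run-≔ (step {j} {js} {τ} v idx)))
      ((λ j → inj₁ (∈-allFin j)) , seg , len)
     ▷ λ (v , seg , len) → (λ j → Sum.[ (λ ()) , id ] (v j)) , seg , len)
    where
    Inv : List (Fin m) → State → Set
    Inv js τ = (∀ j → j Mem.∈ js ⊎ arrays τ mask (toℕ j) ≡ bit (lookup T j)) ×
      Segment (arrays τ queue) (vars τ rd) (map (bit ∘ lookup T) js ++ concatMap bits ms) ×
      vars τ wr ≡ vars τ rd + length (map (bit ∘ lookup T) js ++ concatMap bits ms)
    step : ∀ {j js τ} → Inv (j ∷ js) τ → vars τ index ≡ toℕ j →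
      Inv js (setVar rd (suc (vars τ rd)) (setCell mask (vars τ index) (arrays τ queue (vars τ rd)) τ))
    step {j} {js} {τ} (v , (q≡ , seg) , len) idx = v′ , seg , trans len (+-suc (vars τ rd) _)
      where
      v′ : ∀ j′ → j′ Mem.∈ js ⊎ update (arrays τ mask) (vars τ index) (arrays τ queue (vars τ rd)) (toℕ j′) ≡ bit (lookup T j′)
      v′ j′ with j′ Finₚ.≟ j
      ... | yes refl = inj₂ (trans (update-at (arrays τ mask) _ idx) q≡)
      ... | no j′≢j with v j′
      ...   | inj₁ (here eq)  = contradiction eq j′≢j
      ...   | inj₁ (there j∈) = inj₁ j∈
      ...   | inj₂ eq = inj₂ (trans (update-off (arrays τ mask) _ (λ p → j′≢j (sym (Finₚ.toℕ-injective (trans (sym idx) p))))) eq)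

  expand-run : ∀ {T ms σ} → Input σ → vars σ base ≡ 3 + n → Holds σ (T ∷ ms) →
    Run expand σ (304 * W) (λ τ → ∃[ ks ] Expansion T ks × Holds τ (ms ++ ks) × vars τ next ≡ vars σ next + length ks)
  expand-run {T} {ms} {σ} inp hb holds =
    -- The second argument of `phase` is the remaining budget: `304 = 24 + 23 + 53 + 2 + 64 + 138`,
    -- and 138 consists of 3 for the test, 27 for `markStar` and 108 for `pushChildren`.
    phase 24 280 (framed (fetch-run {T} {ms} inp holds)) λ {τ₁} (sm₁ , msk₁ , h₁) →
    let inp₁ = trans (sameArray sm₁ input refl) inp in
    phase 23 257 (framed (reset-run inp₁)) λ {τ₂} (sm₂ , clr₂) →
    let inp₂ = trans (sameArray sm₂ input refl) inp₁
        hb₂  = trans (sameVar sm₂ base refl) (trans (sameVar sm₁ base refl) hb)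
        msk₂ : HasMask T τ₂
        msk₂ = λ j → trans (cong (λ f → f (toℕ j)) (sameArray sm₂ mask refl)) (msk₁ j)
        h₂ = holds-same {τ₁} {τ₂} {ms} (sameArray sm₂ queue refl) (sameVar sm₂ rd refl) (sameVar sm₂ wr refl) h₁
    in
    phase 53 204 (framed (computeLoads-run {T} inp₂ hb₂ msk₂ clr₂)) λ {τ₃} (sm₃ , lds₃) →
    let inp₃ = trans (sameArray sm₃ input refl) inp₂
        hb₃  = trans (sameVar sm₃ base refl) hb₂
        msk₃ : HasMask T τ₃
        msk₃ = λ j → trans (cong (λ f → f (toℕ j)) (sameArray sm₃ mask refl)) (msk₂ j)
        h₃ = holds-same {τ₂} {τ₃} {ms} (sameArray sm₃ queue refl) (sameVar sm₃ rd refl) (sameVar sm₃ wr refl) h₂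
        mark₃ : ∀ i → arrays τ₃ mark (toℕ {n} i) ≡ 0
        mark₃ = λ i → trans (cong (λ f → f (toℕ i)) (sameArray sm₃ mark refl)) (proj₂ (clr₂ i))
        next₃ = trans (sameVar sm₃ next refl) (trans (sameVar sm₂ next refl) (sameVar sm₁ next refl))
    in
    phase 2 202 (units (run-≔ {Q = _≡ setVar found 0 τ₃} refl)) λ { refl →
    phase 64 138 (framed (findStar-run {T} inp₃ hb₃ msk₃ lds₃ refl)) λ {τ₄} (sm₄ , srch) →
    weaken cost≤ (branching
      {τ₄} (trans (sameArray sm₄ input refl) inp₃) (trans (sameVar sm₄ base refl) hb₃)
      (λ j → trans (cong (λ f → f (toℕ j)) (sameArray sm₄ mask refl)) (msk₃ j))
      (λ i → trans (cong (λ f → f (toℕ i)) (sameArray sm₄ load# refl)) (lds₃ i))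
      (λ i → trans (cong (λ f → f (toℕ i)) (sameArray sm₄ mark refl)) (mark₃ i))
      (holds-same {setVar found 0 τ₃} {τ₄} {ms} (sameArray sm₄ queue refl) (sameVar sm₄ rd refl) (sameVar sm₄ wr refl) h₃)
      (trans (sameVar sm₄ next refl) next₃)
      srch) }
    where
    holds-same : ∀ {τ υ ms} → arrays υ queue ≡ arrays τ queue → vars υ rd ≡ vars τ rd → vars υ wr ≡ vars τ wr →
      Holds τ ms → Holds υ ms
    holds-same {ms = ms} q r w (seg , len) =
      subst₂ (λ f p → Segment f p (concatMap bits ms)) (sym q) (sym r) seg ,
      trans w (trans len (cong (_+ length (concatMap bits ms)) (sym r)))
    cost≤ : 3 + ((27 * W + 108 * W) ⊔ 2) ≤ 138 * W
    cost≤ = ≤-trans (+-mono-≤ (c≤c*W 3) (⊔-lub (≤-reflexive (sym (*-distribʳ-+ W 27 108))) (≤-trans (c≤c*W 2) (*-monoˡ-≤ W (m≤m+n 2 133)))))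
      (≤-reflexive (sym (*-distribʳ-+ W 3 135)))
    branching : ∀ {τ} → Input τ → vars τ base ≡ 3 + n → HasMask T τ → HasLoads T τ →
      (∀ i → arrays τ mark (toℕ {n} i) ≡ 0) → Holds τ ms → vars τ next ≡ vars σ next → Search T [] τ →
      Run (if< (lit 0) (var found) (markStar ⨾ pushChildren) (close ≔ lit 0)) τ (3 + ((27 * W + 108 * W) ⊔ 2))
        (λ υ → ∃[ ks ] Expansion T ks × Holds υ (ms ++ ks) × vars υ next ≡ vars σ next + length ks)
    branching {τ} inp hb msk lds mrk h next≡ (inj₁ (found≡0 , all)) = run-if
      (λ pos → contradiction found≡0 (λ z → <-irrefl (sym z) pos))
      (λ _ → run-≔ ([] , stuck (λ j → Sum.[ (λ ()) , id ] (all j)) ,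
        subst (Holds τ) (sym (++-identityʳ ms)) h , trans next≡ (sym (+-identityʳ _))))
    branching {τ} inp hb msk lds mrk h next≡ (inj₂ (found≡1 , s , st@(¬bl , star≡ , js , seg))) = run-if
      (λ _ → framed (markStar-run {T} {s} inp st mrk) then λ {υ} (sm , mk) →
        pushChildren-run {T} {s} {ms} (trans (sameArray sm input refl) inp) (trans (sameVar sm base refl) hb)
          (λ j → trans (cong (λ f → f (toℕ j)) (sameArray sm mask refl)) (msk j))
          (λ i → trans (cong (λ f → f (toℕ i)) (sameArray sm load# refl)) (lds i))
          mk (¬bl , trans (sameVar sm star refl) star≡ , js , subst (λ p → Segment tape p (encodedSets (s ∷ js))) (sym (sameVar sm starPtr refl)) seg)
          (holds-same {τ} {υ} {ms} (sameArray sm queue refl) (sameVar sm rd refl) (sameVar sm wr refl) h)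
        ▷ λ {υ} (h′ , next≡′) → children T s , branch s ¬bl , h′ , trans next≡′ (cong (_+ length (children T s)) (trans (sameVar sm next refl) next≡)))
      (λ le → contradiction (≤-trans (≤-reflexive (sym found≡1)) le) λ ())

  -- Time is charged to the a priori bound `N` instead of the actual length of the queue, so that
  -- the total cost depends only on `b` and the number of rounds.
  level-run : ∀ {d N ps σ} → d < k → Stage d N ps [] → Input σ → vars σ base ≡ 3 + n → Holds σ ps →
    vars σ next ≡ length ps →
    Run level σ (10 + N * (310 * W)) (λ τ → vars τ rounds ≡ pred (vars σ rounds) ×
      ∃[ ns ] Stage (suc d) (N * b) ns [] × Holds τ ns × vars τ next ≡ length ns)
  level-run {d} {N} {ps} {σ} d<k stage inp hb h next≡ = weaken cost≤
    (≔-then (≔-then (framed (while-run Inv (λ _ → 304 * W + 3) proj₁ (λ {T} {ps} {τ} → step {T} {ps} {τ}) ps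
      (next≡ , inp , hb , [] , subst (Holds σ) (sym (++-identityʳ ps)) h , refl , stage))
     then λ { {τ} (sm , _ , _ , _ , ns , h′ , next≡′ , stage′) →
       run-≔ (cong pred (sameVar sm rounds refl) , ns , descend stage′ , h′ , next≡′) })))
    where
    Inv : List (Subset m) → State → Set
    Inv ps τ = vars τ current ≡ length ps × Input τ × vars τ base ≡ 3 + n ×
      -- Children are appended behind the unprocessed members, so once `ps` is empty the queue is
      -- exactly the next level.
      ∃[ ns ] Holds τ (ps ++ ns) × vars τ next ≡ length ns × Stage d N ps ns
    step : ∀ {T ps τ} → Inv (T ∷ ps) τ → Run (expand ⨾ current ≔ pred-of (var current)) τ (304 * W + 3) (Inv ps)
    step {T} {ps} {τ} (len , inp , hb , ns , h , next≡ , stage) =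
      framed (expand-run {T} {ps ++ ns} inp hb h) then λ { {υ} (sm , ks , ex , h′ , next≡′) →
      run-≔ ( cong pred (trans (sameVar sm current refl) len)
            , trans (sameArray sm input refl) inp , trans (sameVar sm base refl) hb
            , ns ++ ks , subst (Holds υ) (++-assoc ps ns ks) h′
            , trans next≡′ (trans (cong (_+ length ks) next≡) (sym (length-++ ns)))
            , process d<k stage ex) }
    length≤N : length ps ≤ N
    length≤N = *-cancelʳ-≤ (length ps) N b ⦃ >-nonZero 1≤b ⦄ (counted stage)
    cost≤ : 2 + (2 + ((3 + ∑ ps (λ _ → 3 + (304 * W + 3))) + 3)) ≤ 10 + N * (310 * W)
    cost≤ = begin
      4 + ((3 + X) + 3)            ≡⟨ cong (4 +_) (+-comm (3 + X) 3) ⟩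
      10 + X                       ≡⟨ cong (10 +_) (∑-const ps _) ⟩
      10 + length ps * (3 + (304 * W + 3)) ≤⟨ +-monoʳ-≤ 10 (*-mono-≤ length≤N each) ⟩
      10 + N * (310 * W) ∎
      where
      open ≤-Reasoning
      X = ∑ ps (λ _ → 3 + (304 * W + 3))
      each : 3 + (304 * W + 3) ≤ 310 * W
      each = ≤-trans (≤-reflexive (cong (3 +_) (+-comm (304 * W) 3)))
        (≤-trans (+-monoˡ-≤ (304 * W) (c≤c*W 6)) (≤-reflexive (sym (*-distribʳ-+ W 6 304))))

  -- The sum over all rounds

  roundsCost : ℕ → ℕ → ℕ
  roundsCost N zero    = 3
  roundsCost N (suc r) = 3 + (10 + N * (310 * W)) + roundsCost (N * b) r

  rounds-run : ∀ r {d N ps σ} → d + r ≡ k → Stage d N ps [] → Input σ → vars σ base ≡ 3 + n → Holds σ ps →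
    vars σ next ≡ length ps → vars σ rounds ≡ r →
    Run (while< (lit 0) (var rounds) level) σ (roundsCost N r)
      (λ τ → ∃[ N′ ] ∃[ ps′ ] Stage k N′ ps′ [] × vars τ next ≡ length ps′)
  rounds-run zero {d} {N} {ps} d≡k stage inp hb h next≡ r≡ =
    ran (while-false (≤-reflexive r≡)) ≤-refl
      (N , ps , subst (λ d → Stage d N ps []) (trans (sym (+-identityʳ d)) d≡k) stage , next≡)
  rounds-run (suc r) {d} {N} {ps} {σ} d+r≡k stage inp hb h next≡ r≡ =
    while-step (subst (0 <_) (sym r≡) (s≤s z≤n))
      (framed (level-run (subst (d <_) d+r≡k (m<m+n d (s≤s z≤n))) stage inp hb h next≡))
      λ (sm , r≡′ , ns , stage′ , h′ , next≡′) →
        rounds-run r (trans (sym (+-suc d r)) d+r≡k) stage′ (trans (sameArray sm input refl) inp)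
          (trans (sameVar sm base refl) hb) h′ next≡′ (trans r≡′ (cong pred r≡))

  -- The sum `b + b ^ 2 + … + b ^ r` in Horner form.
  geometric : ℕ → ℕ
  geometric zero    = 0
  geometric (suc r) = b + b * geometric r

  -- The summand 2 strengthens the induction: one step needs just `2 ≤ b` to absorb it. For `b = 2`
  -- the bound is an equality.
  geometric-bound : 2 ≤ b → ∀ r → geometric r + 2 ≤ 2 * b ^ r
  geometric-bound 2≤b zero    = ≤-refl
  geometric-bound 2≤b (suc r) = begin
    (b + b * g) + 2      ≤⟨ +-monoʳ-≤ (b + b * g) 2≤b ⟩
    (b + b * g) + b      ≡⟨ +-comm (b + b * g) b ⟩
    b + (b + b * g)      ≡⟨ cong (b +_) (sym (*-suc b g)) ⟩
    b + b * suc g        ≡⟨ sym (*-suc b (suc g)) ⟩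
    b * (2 + g)          ≡⟨ cong (b *_) (+-comm 2 g) ⟩
    b * (g + 2)          ≤⟨ *-monoʳ-≤ b (geometric-bound 2≤b r) ⟩
    b * (2 * b ^ r)      ≡⟨ trans (sym (*-assoc b 2 _)) (trans (cong (_* b ^ r) (*-comm b 2)) (*-assoc 2 b _)) ⟩
    2 * b ^ suc r ∎
    where
    open ≤-Reasoning
    g = geometric r

  -- The factor `b` of each `W` is moved into the sum, which therefore runs from `b` to `b ^ r`.
  -- Each 13 is a guard together with the fixed part 10 of a level; the single 3 is the last guard.
  roundsCost-geometric : ∀ r N → roundsCost N r ≡ 3 + (13 * r + N * (310 * B) * geometric r)
  roundsCost-geometric zero    N = sym (cong (3 +_) (*-zeroʳ (N * (310 * B))))
  roundsCost-geometric (suc r) N = begin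
    13 + N * (310 * W) + roundsCost (N * b) r
      ≡⟨ cong₂ (λ x y → 13 + x + y) NW (trans (roundsCost-geometric r (N * b)) (cong (λ x → 3 + (13 * r + x)) NbG)) ⟩
    13 + κ * b + (3 + (13 * r + κ * (b * g)))
      ≡⟨ solve 4 (λ κ b r g → con 13 :+ κ :* b :+ (con 3 :+ (con 13 :* r :+ κ :* (b :* g)))
           :≡ con 3 :+ (con 13 :* (con 1 :+ r) :+ κ :* (b :+ b :* g))) refl κ b r g ⟩
    3 + (13 * suc r + κ * (b + b * g)) ∎
    where
    open ≡-Reasoning
    κ = N * (310 * B)
    g = geometric r
    NW : N * (310 * W) ≡ κ * b
    NW = trans (cong (N *_) (sym (*-assoc 310 B b))) (sym (*-assoc N (310 * B) b))
    NbG : N * b * (310 * B) * g ≡ κ * (b * g)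
    NbG = solve 4 (λ N b B g → N :* b :* (con 310 :* B) :* g :≡ N :* (con 310 :* B) :* (b :* g)) refl N b B g

  time : ℕ
  time = B * b ^ k

  1≤b^k : 1 ≤ b ^ k
  1≤b^k = m^n>0 b ⦃ >-nonZero 1≤b ⦄ k

  B≤time : B ≤ time
  B≤time = ≤-trans (≤-reflexive (sym (*-identityʳ B))) (*-monoʳ-≤ B 1≤b^k)

  1≤time : 1 ≤ time
  1≤time = ≤-trans 1≤B B≤time

  c≤c*time : ∀ c → c ≤ c * time
  c≤c*time c = ≤-trans (≤-reflexive (sym (*-identityʳ c))) (*-monoʳ-≤ c 1≤time)

  W≤time : 1 ≤ k → W ≤ time
  W≤time 1≤k = *-monoʳ-≤ B (≤-trans (≤-reflexive (sym (*-identityʳ b))) (^-monoʳ-≤ b ⦃ >-nonZero 1≤b ⦄ 1≤k))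

  roundsCost-bound : 2 ≤ b → k ≤ m → roundsCost 1 k ≤ 636 * time
  roundsCost-bound 2≤b k≤m = begin
    roundsCost 1 k                                 ≡⟨ roundsCost-geometric k 1 ⟩
    3 + (13 * k + 1 * (310 * B) * geometric k)     ≤⟨ +-mono-≤ (c≤c*time 3) (+-mono-≤
        -- The fixed cost of the rounds is linear in `k` and is absorbed by `k ≤ m ≤ B`.
        (*-monoʳ-≤ 13 (≤-trans k≤m (≤-trans m≤B B≤time)))
        (*-monoʳ-≤ (1 * (310 * B)) (≤-trans (m≤m+n (geometric k) 2) (geometric-bound 2≤b k)))) ⟩
    3 * time + (13 * time + 1 * (310 * B) * (2 * b ^ k))
      ≡⟨ solve 2 (λ B p → con 3 :* (B :* p) :+ (con 13 :* (B :* p) :+ con 1 :* (con 310 :* B) :* (con 2 :* p))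
           :≡ con 636 :* (B :* p)) refl B (b ^ k) ⟩
    636 * time ∎
    where open ≤-Reasoning

  -- The whole program

  Correct : State → Set
  Correct τ = vars τ answer ≡ 1 ⇔ Solvable

  segment-zero : ∀ (f : A → ℕ) xs p → (∀ x → f x ≡ 0) → Segment (λ _ → 0) p (map f xs ++ [])
  segment-zero f []       p z = tt
  segment-zero f (x ∷ xs) p z = sym (z x) , segment-zero f xs (suc p) z

  search-run : ∀ {σ} → 2 ≤ b → k ≤ m → Input σ → vars σ base ≡ 3 + n → arrays σ queue ≡ (λ _ → 0) → vars σ rd ≡ 0 →
    Run search σ (649 * time) Correct
  search-run {σ} 2≤b k≤m inp hb q≡ rd≡ = weaken cost≤
    (≔-then (≔-then (≔-then (rounds-run k {d = 0} {N = 1} {ps = Subset.⊥ ∷ []} refl start inp hb root refl (cong (λ f → f 2) inp)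
     then λ { {τ} (N′ , ps′ , stage , next≡) → run-if
       (λ lt → run-≔ (mk⇔ (λ _ → Equivalence.to (finish stage) (subst (0 <_) next≡ lt)) (λ _ → refl)))
       (λ ge → run-≔ (mk⇔ (λ ()) (λ sol → contradiction (subst (0 <_) (sym next≡) (Equivalence.from (finish stage) sol)) (≤⇒≯ ge)))) }))))
    where
    root : Segment (arrays σ queue) (vars σ rd) (bits Subset.⊥ ++ []) × arrays σ input 1 ≡ vars σ rd + length (bits Subset.⊥ ++ [])
    root = subst₂ (λ f p → Segment f p (bits Subset.⊥ ++ [])) (sym q≡) (sym rd≡)
        (segment-zero (bit ∘ lookup Subset.⊥) (allFin m) 0 (λ j → cong bit (lookup-replicate j false))) ,
      trans (cong (λ f → f 1) inp) (sym (cong₂ _+_ rd≡ (trans (cong length (++-identityʳ (bits Subset.⊥)))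
        (trans (length-map _ (allFin m)) (length-tabulate {n = m} id)))))
    cost≤ : 3 + (2 + (3 + (roundsCost 1 k + (3 + 2)))) ≤ 649 * time
    cost≤ = begin
      8 + (roundsCost 1 k + 5)  ≡⟨ cong (8 +_) (+-comm (roundsCost 1 k) 5) ⟩
      13 + roundsCost 1 k       ≤⟨ +-mono-≤ (c≤c*time 13) (roundsCost-bound 2≤b k≤m) ⟩
      13 * time + 636 * time    ≡⟨ sym (*-distribʳ-+ time 13 636) ⟩
      649 * time ∎
      where open ≤-Reasoning

  findBase-run : ∀ {σ} → Input σ → Run findBase σ (22 * W) (λ τ → vars τ base ≡ 3 + n)
  findBase-run {σ} inp = phase 2 20 (units (run-≔ {Q = λ τ → Input τ × vars τ base ≡ 3} (inp , refl))) λ { {τ} (inp , b≡) →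
    for-units 2 3 n≤B (for-run (λ is τ → vars τ base + length is ≡ 3 + n) (λ _ → 3) refl refl refl refl (λ v → v)
      (cong (λ f → f 0) inp)
      (λ {i} {is} {τ} v _ → run-≔ (trans (sym (+-suc (vars τ base) (length is))) v))
      (cong₂ _+_ b≡ (length-tabulate {n = n} id))
     ▷ λ v → trans (sym (+-identityʳ _)) v) }

  -- If the check fails, what is kept is `2 ≤ b`: the search then decides the answer, and the
  -- failure serves to bound its running time.
  Verdict : State → Set
  Verdict τ = (vars τ over ≡ 0 × Feasible Subset.⊤) ⊎ (1 ≤ vars τ over × 2 ≤ b)

  checkAll-run : ∀ {σ} → Input σ → vars σ base ≡ 3 + n → Run checkAll σ (125 * W) Verdict
  checkAll-run {σ} inp hb =
    phase 20 105 (framed (for-units 2 3 m≤B (for-run Marked (λ _ → 3) refl refl refl refl (λ v → v) (cong (λ f → f 1) inp)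
      (λ {j} {js} {τ} v idx → run-[]≔ (mark-one {j} {js} {τ} v idx)) (λ j → inj₁ (∈-allFin j)))))
    λ {τ₁} (sm₁ , marked) →
    let inp₁ = trans (sameArray sm₁ input refl) inp
        msk₁ : HasMask Subset.⊤ τ₁
        msk₁ = λ j → trans (Sum.[ (λ ()) , id ] (marked j)) (cong bit (sym (lookup-replicate j true)))
    in
    phase 23 82 (framed (reset-run inp₁)) λ {τ₂} (sm₂ , clr₂) →
    let inp₂ = trans (sameArray sm₂ input refl) inp₁ in
    phase 53 29 (framed (computeLoads-run {Subset.⊤} inp₂ (trans (sameVar sm₂ base refl) (trans (sameVar sm₁ base refl) hb))
      (λ j → trans (cong (λ f → f (toℕ j)) (sameArray sm₂ mask refl)) (msk₁ j)) clr₂)) λ {τ₃} (sm₃ , lds₃) →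
    phase 2 27 (units (run-≔ {Q = λ τ → Input τ × HasLoads Subset.⊤ τ × vars τ over ≡ 0} (trans (sameArray sm₃ input refl) inp₂ , lds₃ , refl)))
    λ { {τ₄} (inp₄ , lds₄ , over≡0) →
    for-units 2 10 n≤B (for-run Checked (λ _ → 10) refl refl refl refl (λ v → v) (cong (λ f → f 0) inp₄)
      (λ {i} {is} {τ} v idx → check-one {i} {is} {τ} v idx)
      (inp₄ , lds₄ , inj₁ (over≡0 , λ i → inj₁ (∈-allFin i)))
     ▷ λ { (_ , _ , v) → Sum.map₁ (λ { (o≡0 , all) → o≡0 , λ i → Sum.[ (λ ()) , id ] (all i) }) v }) }
    where
    Marked : List (Fin m) → State → Set
    Marked js τ = ∀ j → j Mem.∈ js ⊎ arrays τ mask (toℕ j) ≡ 1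
    mark-one : ∀ {j js τ} → Marked (j ∷ js) τ → vars τ index ≡ toℕ j → Marked js (setCell mask (vars τ index) 1 τ)
    mark-one {j} {js} {τ} v idx j′ with vars τ index ≟ toℕ j′
    ... | yes eq = inj₂ (update-at (arrays τ mask) 1 eq)
    ... | no neq with v j′
    ...   | inj₁ (here refl) = contradiction idx neq
    ...   | inj₁ (there j∈)  = inj₁ j∈
    ...   | inj₂ eq          = inj₂ (trans (update-off (arrays τ mask) 1 neq) eq)
    Checked : List (Fin n) → State → Set
    Checked is τ = Input τ × HasLoads Subset.⊤ τ ×
      ((vars τ over ≡ 0 × (∀ i → i Mem.∈ is ⊎ load Subset.⊤ i ≤ cap i)) ⊎ (1 ≤ vars τ over × 2 ≤ b))
    check-one : ∀ {i is τ} → Checked (i ∷ is) τ → vars τ index ≡ toℕ i →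
      Run (if< (capacity index) (load# [ var index ]) (over ≔ lit 1) (close ≔ var close)) τ 10 (Checked is)
    check-one {i} {is} {τ} (inp , lds , v) idx = run-if
      (λ lt → run-≔ (inp , lds , inj₂ (s≤s z≤n , all-infeasible⇒2≤b {i} (subst₂ _<_ cap≡ load≡ lt))))
      (λ le → run-≔ (inp , lds , Sum.map₁ (λ { (o≡0 , all) → o≡0 , λ i′ → advance (subst₂ _≤_ load≡ cap≡ le) (all i′) }) v))
      where
      cap≡ : arrays τ input (3 + vars τ index) ≡ cap i
      cap≡ = trans (cong₂ (λ f x → f (3 + x)) inp idx) (tape-cap i)
      load≡ : arrays τ load# (vars τ index) ≡ load Subset.⊤ i
      load≡ = trans (cong (arrays τ load#) idx) (lds i)
      advance : ∀ {i′} → load Subset.⊤ i ≤ cap i → i′ Mem.∈ (i ∷ is) ⊎ load Subset.⊤ i′ ≤ cap i′ → i′ Mem.∈ is ⊎ load Subset.⊤ i′ ≤ cap i′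
      advance le (inj₁ (here refl)) = inj₂ le
      advance le (inj₁ (there i∈))  = inj₁ i∈
      advance le (inj₂ le′)         = inj₂ le′

  solver-run : Run solver (initial (encodeInstance I)) (1000 * time) Correct
  solver-run = weaken cost≤
    (run-if {d = 808 * time} (λ k<1 → run-≔ (mk⇔ (λ _ → k≡0⇒solvable (n<1⇒n≡0 k<1)) (λ _ → refl)))
      (λ 1≤k → weaken (inner 5 803)
        (run-if {c = 803 * time} {d = 803 * time}
          (λ m<k → weaken (≤-trans (m≤m+n 2 801) (c≤c*time 803)) (run-≔ (mk⇔ (λ ()) (λ sol → contradiction sol (m<k⇒unsolvable m<k)))))
          (λ k≤m → body 1≤k k≤m))))
    where
    inner : ∀ e c → e + (c * time ⊔ c * time) ≤ (e + c) * time
    inner e c = ≤-trans (+-mono-≤ (c≤c*time e) (≤-reflexive (⊔-idem (c * time)))) (≤-reflexive (sym (*-distribʳ-+ time e c)))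
    cost≤ : 4 + (2 ⊔ (808 * time)) ≤ 1000 * time
    cost≤ = ≤-trans (+-mono-≤ (c≤c*time 4) (⊔-lub (≤-trans (m≤m+n 2 806) (c≤c*time 808)) ≤-refl))
      -- The accounting gives 812, which is rounded up to 1000.
      (≤-trans (≤-reflexive (sym (*-distribʳ-+ time 4 808))) (*-monoˡ-≤ time (m≤m+n 812 188)))
    body : 1 ≤ k → k ≤ m →
      Run (findBase ⨾ checkAll ⨾ if< (var over) (lit 1) (answer ≔ lit 1) search) (initial (encodeInstance I)) (803 * time) Correct
    body 1≤k k≤m = weaken body≤
      (framed (findBase-run refl) then λ {τ₁} (sm₁ , hb₁) →
       framed (checkAll-run (sameArray sm₁ input refl) hb₁) then λ {τ₂} (sm₂ , verdict) →
       run-if {c = 649 * time} {d = 649 * time}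
         (λ o<1 → weaken (≤-trans (m≤m+n 2 647) (c≤c*time 649)) (run-≔ (mk⇔ (λ _ → all-feasible⇒solvable k≤m (feasible {τ₂} o<1 verdict)) (λ _ → refl))))
         (λ 1≤o → search-run (2≤b {τ₂} 1≤o verdict) k≤m
           (trans (sameArray sm₂ input refl) (sameArray sm₁ input refl))
           (trans (sameVar sm₂ base refl) hb₁)
           (trans (sameArray sm₂ queue refl) (sameArray sm₁ queue refl))
           (trans (sameVar sm₂ rd refl) (sameVar sm₁ rd refl))))
      where
      feasible : ∀ {τ} → vars τ over < 1 → Verdict τ → Feasible Subset.⊤
      feasible o<1 (inj₁ (_ , feas)) = feas
      feasible o<1 (inj₂ (1≤o , _))  = contradiction 1≤o (<⇒≱ o<1)
      2≤b : ∀ {τ} → 1 ≤ vars τ over → Verdict τ → 2 ≤ b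
      2≤b 1≤o (inj₁ (o≡0 , _)) = contradiction o≡0 (λ z → <-irrefl (sym z) 1≤o)
      2≤b 1≤o (inj₂ (_ , 2≤b)) = 2≤b
      body≤ : 22 * W + (125 * W + (3 + (649 * time ⊔ 649 * time))) ≤ 803 * time
      body≤ = begin
        22 * W + (125 * W + (3 + (649 * time ⊔ 649 * time))) ≤⟨ +-mono-≤ (*-monoʳ-≤ 22 W≤) (+-mono-≤ (*-monoʳ-≤ 125 W≤) (inner 3 649)) ⟩
        22 * time + (125 * time + 652 * time) ≡⟨ cong (22 * time +_) (sym (*-distribʳ-+ time 125 652)) ⟩
        22 * time + 777 * time                ≡⟨ sym (*-distribʳ-+ time 22 777) ⟩
        799 * time                            ≤⟨ *-monoˡ-≤ time (m≤m+n 799 4) ⟩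
        803 * time ∎
        where
        open ≤-Reasoning
        -- The check before the search costs a multiple of `B * b`, and `time` contains a factor `b`
        -- because `k` is positive.
        W≤ = W≤time 1≤k

theorem1 : SolvableInTimeO SetCoverWithCapacities timeBound
theorem1 = solver , 1000 , λ I →
  let r = Verification.solver-run I in final r , steps r , exec r , bound r , holds r
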